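{- Let $G$ be a finite simple graph on $n\ge1$ vertices and let $v\in V(G)$. Let $p_G(v)$ be the probability that $v$ is selected as a pivot in the Caro--Wei process on $G$, and for an edge $vu\in E(G)$ let $q_G(vu)$ be the probability that $v$ and $u$ lie in different blocks of the Caro--Wei process on $G$. Then $$\frac1{p_G(v)}+\sum_{u\in N_G(v)}\frac1{q_G(vu)}\le n.$$
   Context: Graphs are finite and simple; $N_G(v)$ denotes the open neighborhood of $v$ in $G$ (so $v\notin N_G(v)$). Caro--Wei process: given a graph $G$, choose a uniformly random ordering of $V(G)$. Start with $S_0=V(G)$. As long as $S_i\neq\varnothing$, let $x_i$ be the first vertex of $S_i$ in the chosen order, called a pivot, and set $S_{i+1}=S_i\cap N_G(x_i)$ and $B_i=S_i\setminus S_{i+1}$. Stop when $S_i=\varnothing$. The sets $B_0,B_1,\ldots$ are the blocks of the process; in every outcome they form a partition of $V(G)$. For $v\in V(G)$ and $uv\in E(G)$ define $$p_G(v)=\Pr(v\text{ is selected as a pivot}),\qquad q_G(uv)=\Pr(u\text{ and }v\text{ lie in different blocks}),$$ the probabilities being over the uniformly random ordering of $V(G)$. -}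

module Defs where

open import Algebra.Definitions.RawMonoid using (sum)
open import Data.Empty using (⊥-elim)
open import Data.Fin using (Fin)
import Data.Fin.Properties as Fin
open import Data.Integer using (+_)
open import Data.List using (List; []; _∷_; _++_; map; concatMap; filter; head; length; allFin)
open import Data.List.Membership.Propositional using (_∈_; _∉_)
open import Data.List.Membership.Propositional.Properties using (∈-map⁺; ∈-map⁻; ∈-concatMap⁺; ∈-concatMap⁻; ∈-filter⁺; ∈-filter⁻; ∈-allFin; ∈-∃++)
open import Data.List.Properties using (length-filter; length-++; length-map; length-tabulate; filter-reject; ∷-injectiveʳ)
open import Data.List.Relation.Binary.Disjoint.Propositional using (Disjoint)
open import Data.List.Relation.Binary.Permutation.Propositional using (_↭_; ↭-refl; ↭-sym; ↭-trans; prep; swap)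
open import Data.List.Relation.Binary.Permutation.Propositional.Properties using (∈-resp-↭; drop-mid; shift; ↭-length)
open import Data.List.Relation.Unary.All as All using (All; []; _∷_)
open import Data.List.Relation.Unary.All.Properties using (All¬⇒¬Any)
import Data.List.Relation.Unary.All.Properties as All
open import Data.List.Relation.Unary.AllPairs as AllPairs using (AllPairs; []; _∷_)
import Data.List.Relation.Unary.AllPairs.Properties as AllPairs
open import Data.List.Relation.Unary.Any as Any using (here; there)
open import Data.List.Relation.Unary.Unique.Propositional using (Unique)
import Data.List.Relation.Unary.Unique.Propositional.Properties as Unique
open import Data.Maybe using (just)
import Data.Maybe.Properties as Maybe
open import Data.Nat using (ℕ; zero; suc; pred; _+_; _*_; _∸_; _≤_; _<_; z≤n; _!; NonZero)
open import Data.Nat.Properties using (_!≢0; anyUpTo?; ≤-refl; ≤-trans; ≤-reflexive; <-irrefl; pred-mono-≤; +-suc; +-identityʳ; m≤n+m)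
import Data.Nat.Properties as ℕ
open import Data.Product using (∃; ∃₂; _×_; _,_; proj₂)
open import Data.Rational as ℚ using (ℚ; 0ℚ; _/_)
import Data.Rational.Properties as ℚ
open import Function using (_∘_)
open import Level using (0ℓ)
open import Relation.Binary using (Rel; Symmetric; Irreflexive; Decidable)
open import Relation.Binary.PropositionalEquality using (_≡_; _≢_; refl; sym; trans; cong; cong₂; subst)
open import Relation.Nullary using (¬_; Dec; yes; no; ¬?)
open import Relation.Nullary.Decidable using (map′; _×-dec_)
import Relation.Unary as U

import Data.List.Membership.DecPropositional as DecMembership

------------------------------------------------------------------------
-- Finite simple graphs

record Graph (n : ℕ) : Set₁ where
  field
    Adj        : Rel (Fin n) 0ℓ
    adj?       : Decidable Adj
    adj-sym    : Symmetric Adj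
    adj-irrefl : Irreflexive _≡_ Adj

open Graph public

-- ∑N G v f is the sum of f u over the neighbours u of v; the summand may
-- use the proof that vu is an edge.
∑N : ∀ {n} (G : Graph n) (v : Fin n) → (∀ u → Adj G v u → ℚ) → ℚ
∑N G v f = sum ℚ.+-0-rawMonoid (λ u → term u (adj? G v u))
  where
  term : ∀ u → Dec (Adj G v u) → ℚ
  term u (yes vu) = f u vu
  term u (no _)   = 0ℚ

------------------------------------------------------------------------
-- Orderings of the vertex set

module _ {A : Set} where

  insertions : A → List A → List (List A)
  insertions x []       = (x ∷ []) ∷ []
  insertions x (y ∷ ys) = (x ∷ y ∷ ys) ∷ map (y ∷_) (insertions x ys)

  permutations : List A → List (List A)
  permutations []       = [] ∷ []
  permutations (x ∷ xs) = concatMap (insertions x) (permutations xs)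

-- An ordering of Fin n is a list in which every vertex occurs exactly
-- once, earliest first.
orderings : ∀ n → List (List (Fin n))
orderings n = permutations (allFin n)

Pr : ∀ {n} {P : U.Pred (List (Fin n)) 0ℓ} → U.Decidable P → ℚ
Pr {n} P? = (+ length (filter P? (orderings n)) / n !) {{n !≢0}}

------------------------------------------------------------------------
-- The Caro–Wei process

-- A set S_i is represented by the list of its elements in the chosen
-- order, so that its first vertex is its head. The sequence is continued
-- by S_i = ∅ after the process has stopped.
module _ {n} (G : Graph n) where

  step : List (Fin n) → List (Fin n)
  step []       = []
  step (x ∷ xs) = filter (adj? G x) (x ∷ xs)

  S : List (Fin n) → ℕ → List (Fin n)
  S σ zero    = σ
  S σ (suc i) = step (S σ i)

  InBlock : List (Fin n) → ℕ → Fin n → Set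
  InBlock σ i v = v ∈ S σ i × v ∉ S σ (suc i)

  IsPivot : Fin n → List (Fin n) → Set
  IsPivot v σ = ∃ λ i → head (S σ i) ≡ just v

  DifferentBlocks : Fin n → Fin n → List (Fin n) → Set
  DifferentBlocks u v σ = ∃₂ λ i j → i ≢ j × InBlock σ i u × InBlock σ j v

  open DecMembership (Fin._≟_ {n}) using (_∈?_)

  length-step : ∀ xs → length (step xs) ≤ pred (length xs)
  length-step []       = z≤n
  length-step (x ∷ xs)
    rewrite filter-reject (adj? G x) {x} {xs} (adj-irrefl G refl)
    = length-filter (adj? G x) xs

  length-S : ∀ σ i → length (S σ i) ≤ length σ ∸ i
  length-S σ zero    = ≤-refl
  length-S σ (suc i) = ≤-trans (length-step (S σ i))
    (≤-trans (pred-mono-≤ (length-S σ i)) (≤-reflexive (ℕ.pred[m∸n]≡m∸[1+n] (length σ) i)))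

  ∈S⇒< : ∀ {v} σ i → v ∈ S σ i → i < length σ
  ∈S⇒< {v} σ i v∈ = ℕ.≰⇒> λ ∣σ∣≤i → empty v∈
    (≤-trans (length-S σ i) (≤-reflexive (ℕ.m≤n⇒m∸n≡0 ∣σ∣≤i)))
    where
    empty : ∀ {xs : List (Fin n)} → v ∈ xs → ¬ length xs ≤ 0
    empty (here _)  ()
    empty (there _) ()

  head⇒∈ : ∀ {v : Fin n} xs → head xs ≡ just v → v ∈ xs
  head⇒∈ (x ∷ xs) refl = here refl

  InBlock? : ∀ σ i v → Dec (InBlock σ i v)
  InBlock? σ i v = (v ∈? S σ i) ×-dec ¬? (v ∈? S σ (suc i))

  IsPivot? : ∀ v → U.Decidable (IsPivot v)
  IsPivot? v σ = map′
    (λ (i , _ , eq) → i , eq)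
    (λ (i , eq) → i , ∈S⇒< σ i (head⇒∈ (S σ i) eq) , eq)
    (anyUpTo? (λ i → Maybe.≡-dec Fin._≟_ (head (S σ i)) (just v)) (length σ))

  DifferentBlocks? : ∀ u v → U.Decidable (DifferentBlocks u v)
  DifferentBlocks? u v σ = map′
    (λ (i , _ , j , _ , d) → i , j , d)
    (λ (i , j , d@(_ , (u∈ , _) , (v∈ , _))) → i , ∈S⇒< σ i u∈ , j , ∈S⇒< σ j v∈ , d)
    (anyUpTo? (λ i → anyUpTo? (λ j → ¬? (i ℕ.≟ j) ×-dec InBlock? σ i u ×-dec InBlock? σ j v)
      (length σ)) (length σ))

  p : Fin n → ℚ
  p v = Pr (IsPivot? v)

  q : (u v : Fin n) → Adj G u v → ℚ
  q u v _ = Pr (DifferentBlocks? u v)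

------------------------------------------------------------------------
-- permutations xs lists every rearrangement of xs, and, when xs has no
-- repetitions, lists it once.

module _ {A : Set} where

  ∈-insertions⁺ : ∀ (x : A) as bs → as ++ x ∷ bs ∈ insertions x (as ++ bs)
  ∈-insertions⁺ x []       []       = here refl
  ∈-insertions⁺ x []       (b ∷ bs) = here refl
  ∈-insertions⁺ x (a ∷ as) bs       = there (∈-map⁺ (a ∷_) (∈-insertions⁺ x as bs))

  ∈-insertions⁻ : ∀ (x : A) ys {zs} → zs ∈ insertions x ys → zs ↭ x ∷ ys
  ∈-insertions⁻ x []       (here refl) = ↭-refl
  ∈-insertions⁻ x (y ∷ ys) (here refl) = ↭-refl
  ∈-insertions⁻ x (y ∷ ys) (there zs∈) with ∈-map⁻ (y ∷_) zs∈
  ... | ws , ws∈ , refl = ↭-trans (prep y (∈-insertions⁻ x ys ws∈)) (swap y x ↭-refl)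

  ∈-permutations⁺ : ∀ (xs : List A) {ys} → ys ↭ xs → ys ∈ permutations xs
  ∈-permutations⁺ []       {[]}    _     = here refl
  ∈-permutations⁺ []       {_ ∷ _} ys↭   with () ← ↭-length ys↭
  ∈-permutations⁺ (x ∷ xs) ys↭ with ∈-∃++ (∈-resp-↭ (↭-sym ys↭) (here refl))
  ... | as , bs , refl = ∈-concatMap⁺ (insertions x)
    (Any.map (λ eq → subst (λ ws → as ++ x ∷ bs ∈ insertions x ws) eq (∈-insertions⁺ x as bs))
      (∈-permutations⁺ xs (drop-mid as [] ys↭)))

  ∈-permutations⁻ : ∀ (xs : List A) {ys} → ys ∈ permutations xs → ys ↭ xs
  ∈-permutations⁻ []       (here refl) = ↭-refl
  ∈-permutations⁻ (x ∷ xs) ys∈ = go (∈-concatMap⁻ (insertions x) ys∈) (λ {w} → ∈-permutations⁻ xs {w})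
    where
    go : ∀ {yss ys} → Any.Any (λ ws → ys ∈ insertions x ws) yss →
         (∀ {ws} → ws ∈ yss → ws ↭ xs) → ys ↭ x ∷ xs
    go (here ys∈)  f = ↭-trans (∈-insertions⁻ x _ ys∈) (prep x (f (here refl)))
    go (there any) f = go any (λ ws∈ → f (there ws∈))

  insertions-unique : ∀ (x : A) {ys} → x ∉ ys → Unique (insertions x ys)
  insertions-unique x {[]}     x∉ = [] ∷ []
  insertions-unique x {y ∷ ys} x∉ =
    All.map⁺ (All.tabulate λ {_} _ → λ { refl → x∉ (here refl) })
    ∷ Unique.map⁺ ∷-injectiveʳ (insertions-unique x (x∉ ∘ there))

  insertions-injective : ∀ (x : A) {ys zs ws} → x ∉ ys → x ∉ zs →
                         ws ∈ insertions x ys → ws ∈ insertions x zs → ys ≡ zs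
  insertions-injective x {[]} {[]} _ _ _ _ = refl
  insertions-injective x {[]} {z ∷ zs} _ x∉ (here refl) (there ws∈) with ∈-map⁻ (z ∷_) ws∈
  ... | _ , _ , refl = ⊥-elim (x∉ (here refl))
  insertions-injective x {y ∷ ys} {[]} x∉ _ (there ws∈) (here refl) with ∈-map⁻ (y ∷_) ws∈
  ... | _ , _ , refl = ⊥-elim (x∉ (here refl))
  insertions-injective x {y ∷ ys} {z ∷ zs} _ _ (here refl) (here refl) = refl
  insertions-injective x {y ∷ ys} {z ∷ zs} _ x∉ (here refl) (there ws∈) with ∈-map⁻ (z ∷_) ws∈
  ... | _ , _ , refl = ⊥-elim (x∉ (here refl))
  insertions-injective x {y ∷ ys} {z ∷ zs} x∉ _ (there ws∈) (here refl) with ∈-map⁻ (y ∷_) ws∈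
  ... | _ , _ , refl = ⊥-elim (x∉ (here refl))
  insertions-injective x {y ∷ ys} {z ∷ zs} x∉ x∉′ (there ws∈) (there ws∈′)
    with ∈-map⁻ (y ∷_) ws∈ | ∈-map⁻ (z ∷_) ws∈′
  ... | _ , a , refl | _ , b , refl =
    cong (y ∷_) (insertions-injective x (x∉ ∘ there) (x∉′ ∘ there) a b)

  permutations-unique : ∀ {xs : List A} → Unique xs → Unique (permutations xs)
  permutations-unique {[]}     []          = [] ∷ []
  permutations-unique {x ∷ xs} (x≢ ∷ uniq) = Unique.concat⁺
    (All.map⁺ (All.tabulate (λ ys∈ → insertions-unique x (x∉ ys∈))))
    (AllPairs.map⁺ (disjoint x∉ (permutations-unique uniq)))
    where
    x∉ : ∀ {ys} → ys ∈ permutations xs → x ∉ ys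
    x∉ ys∈ x∈ = All¬⇒¬Any x≢ (∈-resp-↭ (∈-permutations⁻ xs ys∈) x∈)

    disjoint : ∀ {yss} → (∀ {ys} → ys ∈ yss → x ∉ ys) → Unique yss →
               AllPairs (λ ys zs → Disjoint (insertions x ys) (insertions x zs)) yss
    disjoint _ []        = []
    disjoint f (ys≢ ∷ u) =
      All.tabulate (λ zs∈ (a , b) →
        All.lookup ys≢ zs∈ (insertions-injective x (f (here refl)) (f (there zs∈)) a b))
      ∷ disjoint (f ∘ there) u

  length-insertions : ∀ (x : A) ys → length (insertions x ys) ≡ suc (length ys)
  length-insertions x []       = refl
  length-insertions x (y ∷ ys) = cong suc
    (trans (length-map (y ∷_) (insertions x ys)) (length-insertions x ys))

  length-permutations : ∀ (xs : List A) → length (permutations xs) ≡ length xs !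
  length-permutations []       = refl
  length-permutations (x ∷ xs) = trans
    (go (permutations xs) (λ ys∈ → ↭-length (∈-permutations⁻ xs ys∈)))
    (trans (cong (_* suc (length xs)) (length-permutations xs))
           (ℕ.*-comm (length xs !) (suc (length xs))))
    where
    go : ∀ yss → (∀ {ys} → ys ∈ yss → length ys ≡ length xs) →
         length (concatMap (insertions x) yss) ≡ length yss * suc (length xs)
    go []         _ = refl
    go (ys ∷ yss) f = trans (length-++ (insertions x ys))
      (cong₂ _+_ (trans (length-insertions x ys) (cong suc (f (here refl)))) (go yss (f ∘ there)))

orderings-unique : ∀ n → Unique (orderings n)
orderings-unique n = permutations-unique (Unique.allFin⁺ n)

length-orderings : ∀ n → length (orderings n) ≡ n !
length-orderings n = trans (length-permutations (allFin n)) (cong _! (length-tabulate {n = n} (λ i → i)))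

------------------------------------------------------------------------
-- The probabilities p and q are nonzero: any ordering that starts with v
-- makes v a pivot and separates v from all of its neighbours.

startingWith : ∀ {n} (v : Fin n) → ∃ λ xs → v ∷ xs ∈ orderings n
startingWith {n} v with ∈-∃++ (∈-allFin v)
... | as , bs , eq = as ++ bs ,
  ∈-permutations⁺ (allFin n) (subst (v ∷ as ++ bs ↭_) (sym eq) (↭-sym (shift v as bs)))

Pr-nonZero : ∀ {n} {P : U.Pred (List (Fin n)) 0ℓ} (P? : U.Decidable P) {σ} →
             σ ∈ orderings n → P σ → ℚ.NonZero (Pr P?)
Pr-nonZero {n} P? σ∈ Pσ = ℚ.pos⇒nonZero (Pr P?)
  {{ℚ.normalize-pos _ (n !) {{n !≢0}} {{nonEmpty (∈-filter⁺ P? σ∈ Pσ)}}}}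
  where
  nonEmpty : ∀ {x} {xs : List (List (Fin n))} → x ∈ xs → NonZero (length xs)
  nonEmpty (here _)  = _
  nonEmpty (there _) = _

module _ {n} (G : Graph n) where

  open DecMembership (Fin._≟_ {n}) using (_∈?_)

  eventuallyInBlock : ∀ {v} σ i → v ∈ S G σ i → ∃ λ j → i ≤ j × InBlock G σ j v
  eventuallyInBlock {v} σ i v∈ = go (length σ) i v∈ (m≤n+m (length σ) i)
    where
    go : ∀ k i → v ∈ S G σ i → length σ ≤ i + k → ∃ λ j → i ≤ j × InBlock G σ j v
    go zero i v∈ le = ⊥-elim (<-irrefl refl
      (≤-trans (∈S⇒< G σ i v∈) (≤-trans le (≤-reflexive (+-identityʳ i)))))
    go (suc k) i v∈ le with v ∈? S G σ (suc i)
    ... | no  v∉  = i , ≤-refl , v∈ , v∉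
    ... | yes v∈′ with go k (suc i) v∈′ (≤-trans le (≤-reflexive (+-suc i k)))
    ... | j , i<j , b = j , ℕ.<⇒≤ i<j , b

  pivotOrdering : ∀ v → ∃ λ σ → σ ∈ orderings n × IsPivot G v σ
  pivotOrdering v = let xs , σ∈ = startingWith v in v ∷ xs , σ∈ , 0 , refl

  separatingOrdering : ∀ u v → Adj G u v → ∃ λ σ → σ ∈ orderings n × DifferentBlocks G u v σ
  separatingOrdering u v uv with startingWith u
  ... | xs , σ∈ with eventuallyInBlock {v} (u ∷ xs) 1 (∈-filter⁺ (adj? G u) v∈ uv)
    where
    v∈ : v ∈ u ∷ xs
    v∈ = ∈-resp-↭ (↭-sym (∈-permutations⁻ (allFin n) σ∈)) (∈-allFin v)
  ... | j , 1≤j , b = u ∷ xs , σ∈ , 0 , j , (λ { refl → <-irrefl refl 1≤j })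
    , (here refl , λ u∈ → adj-irrefl G refl (proj₂ (∈-filter⁻ (adj? G u) {xs = u ∷ xs} u∈)))
    , b

  p-nonZero : ∀ v → ℚ.NonZero (p G v)
  p-nonZero v = let _ , σ∈ , pivot = pivotOrdering v in
    Pr-nonZero (IsPivot? G v) σ∈ pivot

  q-nonZero : ∀ u v (uv : Adj G u v) → ℚ.NonZero (q G u v uv)
  q-nonZero u v uv = let _ , σ∈ , different = separatingOrdering u v uv in
    Pr-nonZero (DifferentBlocks? G u v) σ∈ different

  1/p : Fin n → ℚ
  1/p v = (ℚ.1/ p G v) {{p-nonZero v}}

  1/q : (u v : Fin n) → Adj G u v → ℚ
  1/q u v uv = (ℚ.1/ q G u v uv) {{q-nonZero u v uv}}

{-# OPTIONS --safe #-}

-- For a set L of vertices containing v and for u ∈ N[v], let E_L(u) be the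
-- probability that the process on G[L] selects v as a pivot (u = v), or
-- separates u from v (u ≠ v).  By induction on |L| we show
-- ∑ 1/E_L(u) ≤ |L|, the sum being over u ∈ K = L ∩ N[v].
--
-- Conditioning on the first pivot x, |L| E_L(u) is at least the sum over x of
--   1                if x = v or x is adjacent to exactly one of u and v,
--   E_{L ∩ N(x)}(u)  if x is adjacent to both,
-- so Cauchy–Schwarz bounds 1/(|L| E_L(u)) by a weighted sum of reciprocals,
-- for which the induction hypothesis is available.  The weights are
-- min(c_x, c_u) for x ∈ K and c_u for x ∉ K adjacent to u, where
-- c : K → ℚ solves ω_u c_u + ∑_{x ∈ K} min(c_x, c_u) = s := ∑_{x ∈ K} c_x, and
-- ω_u is the number of neighbours of u in L ∖ K.  The induction hypothesis for
-- x says that the reciprocals exceed 1 by at most ω_x in total, and the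
-- resulting bound for ∑ s²/(|L| E_L(u)) collapses to
--   2 ∑ ω_u c_u² + ∑∑ min(c_x, c_u)² = 2 s² − ∑∑ c_x c_u = s².
module Submission where

open import Defs
open import Algebra.Definitions.RawMonoid using (sum)
open import Data.Empty using (⊥-elim)
open import Data.Fin using (Fin; zero; suc)
import Data.Fin.Properties as Fin
open import Data.Integer using (+_)
import Data.Integer as ℤ
import Data.Integer.Properties as ℤ
open import Data.List using (List; []; _∷_; _++_; map; concatMap; filter; length; allFin; tabulate)
import Data.List.Membership.DecPropositional as DecMembership
open import Data.List.Membership.Propositional using (_∈_; lose)
open import Data.List.Membership.Propositional.Properties using (∈-map⁻; ∈-filter⁺; ∈-filter⁻; ∈-allFin)
open import Data.List.Properties using (filter-accept; filter-reject; filter-none; filter-notAll; length-tabulate)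
open import Data.List.Relation.Binary.Permutation.Propositional using (_↭_; ↭-refl; ↭-sym; ↭-trans; prep; swap)
open import Data.List.Relation.Binary.Permutation.Propositional.Properties using (∈-resp-↭)
import Data.List.Relation.Unary.All as All
open import Data.List.Relation.Unary.Any using (here; there)
open import Data.Nat as ℕ using (ℕ; zero; suc; _⊔_; _≥_; _!)
import Data.Nat.Properties as ℕ
open import Data.Product using (∃; _×_; _,_; proj₁; proj₂)
open import Data.Rational as ℚ using (ℚ; 0ℚ; 1ℚ; _+_; _*_; _-_; -_; _≤_; _<_; _/_)
import Data.Rational.Properties as ℚ
open import Data.Rational.Solver using (module +-*-Solver)
import Data.Rational.Unnormalised as ℚᵘ
import Data.Rational.Unnormalised.Properties as ℚᵘ
open import Data.Sum using (_⊎_; inj₁; inj₂)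
open import Function using (_∘_)
open import Level using (0ℓ)
open import Relation.Binary.PropositionalEquality using (_≡_; _≢_; refl; sym; trans; cong; cong₂; subst; subst₂; module ≡-Reasoning)
open import Relation.Nullary using (¬_; Dec; yes; no; ¬?)
open import Relation.Nullary.Decidable using (_×-dec_; _⊎-dec_)
import Relation.Unary as U

open +-*-Solver using (solve; _:=_; _:+_; _:*_; _:-_; con)

-- Ordered-field facts about the rationals.

0≤1 : 0ℚ ≤ 1ℚ
0≤1 = ℚ.nonNegative⁻¹ 1ℚ

0<1 : 0ℚ < 1ℚ
0<1 = ℚ.positive⁻¹ 1ℚ

*-mono-≤ : ∀ {a b c} → 0ℚ ≤ c → a ≤ b → c * a ≤ c * b
*-mono-≤ {c = c} 0≤c = ℚ.*-monoˡ-≤-nonNeg c {{ℚ.nonNegative 0≤c}}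

*-nonNeg : ∀ {a b} → 0ℚ ≤ a → 0ℚ ≤ b → 0ℚ ≤ a * b
*-nonNeg {a} {b} 0≤a 0≤b = subst (_≤ a * b) (ℚ.*-zeroʳ a) (*-mono-≤ 0≤a 0≤b)

*-pos : ∀ {a b} → 0ℚ < a → 0ℚ < b → 0ℚ < a * b
*-pos {a} {b} 0<a 0<b =
  ℚ.positive⁻¹ (a * b) {{ℚ.pos*pos⇒pos a {{ℚ.positive 0<a}} b {{ℚ.positive 0<b}}}}

+-nonNeg : ∀ {a b} → 0ℚ ≤ a → 0ℚ ≤ b → 0ℚ ≤ a + b
+-nonNeg = ℚ.+-mono-≤

≤-from-difference : ∀ {a b d} → 0ℚ ≤ d → a + d ≡ b → a ≤ b
≤-from-difference {a} 0≤d eq = subst₂ _≤_ (ℚ.+-identityʳ a) eq (ℚ.+-monoʳ-≤ a 0≤d)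

≤⇒0≤- : ∀ {a b} → a ≤ b → 0ℚ ≤ b - a
≤⇒0≤- {a} {b} a≤b = subst (_≤ b - a) (ℚ.+-inverseʳ a) (ℚ.+-monoˡ-≤ (- a) a≤b)

square-nonNeg : ∀ a → 0ℚ ≤ a * a
square-nonNeg a with ℚ.≤-total 0ℚ a
... | inj₁ 0≤a = *-nonNeg 0≤a 0≤a
... | inj₂ a≤0 = subst (0ℚ ≤_) (solve 1 (λ a → (con 0ℚ :- a) :* (con 0ℚ :- a) := a :* a) refl a)
  (*-nonNeg (≤⇒0≤- a≤0) (≤⇒0≤- a≤0))

reciprocal : ∀ {a} → 0ℚ < a → ∃ λ b → 0ℚ < b × b * a ≡ 1ℚ
reciprocal {a} 0<a =
  let instance
        a⁺ = ℚ.positive 0<a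
        a≢0 = ℚ.pos⇒nonZero a
  in ℚ.1/ a , ℚ.positive⁻¹ (ℚ.1/ a) {{ℚ.1/pos⇒pos a}} , ℚ.*-inverseˡ a

1/-≤ : ∀ {a b} .{{_ : ℚ.NonZero a}} → 0ℚ ≤ a → 1ℚ ≤ b * a → ℚ.1/ a ≤ b
1/-≤ {a} 0≤a 1≤ba = ℚ.*-cancelʳ-≤-pos a
  {{ℚ.nonNeg∧nonZero⇒pos a {{ℚ.nonNegative 0≤a}}}}
  (ℚ.≤-trans (ℚ.≤-reflexive (ℚ.*-inverseˡ a)) 1≤ba)

*-cancelˡ : ∀ {a b c} → 0ℚ < c → c * a ≡ c * b → a ≡ b
*-cancelˡ {c = c} 0<c eq = ℚ.≤-antisym (cancel (ℚ.≤-reflexive eq)) (cancel (ℚ.≤-reflexive (sym eq)))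
  where
  cancel : ∀ {a b} → c * a ≤ c * b → a ≤ b
  cancel = ℚ.*-cancelˡ-≤-pos c {{ℚ.positive 0<c}}

-- The embedding of the naturals into the rationals.

ι : ℕ → ℚ
ι n = + n / 1

/-* : ∀ m n .{{_ : ℕ.NonZero n}} → (+ m / n) * ι n ≡ ι m
/-* m n@(suc n-1) = ℚ.toℚᵘ-injective (ℚᵘ.≃-trans (ℚ.toℚᵘ-homo-* (+ m / n) (ι n))
  (ℚᵘ.≃-trans (ℚᵘ.*-cong (ℚ.toℚᵘ-fromℚᵘ (ℚᵘ.mkℚᵘ (+ m) n-1)) (ℚ.toℚᵘ-fromℚᵘ (ℚᵘ.mkℚᵘ (+ n) 0)))
  (ℚᵘ.≃-trans (ℚᵘ.*≡* (trans (ℤ.*-identityʳ (+ m ℤ.* + n))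
      (cong (λ k → + m ℤ.* + k) (sym (ℕ.*-identityʳ n)))))
    (ℚᵘ.≃-sym (ℚ.toℚᵘ-fromℚᵘ (ℚᵘ.mkℚᵘ (+ m) 0))))))

ι-suc : ∀ n → ι (suc n) ≡ 1ℚ + ι n
ι-suc n = ℚ.toℚᵘ-injective (ℚᵘ.≃-trans (ℚ.toℚᵘ-fromℚᵘ (ℚᵘ.mkℚᵘ (+ suc n) 0))
  (ℚᵘ.≃-trans (ℚᵘ.*≡* (cong (λ z → z ℤ.* + 1) (sym (cong (λ z → + 1 ℤ.+ z) (ℤ.*-identityʳ (+ n))))))
  (ℚᵘ.≃-trans (ℚᵘ.+-cong (ℚᵘ.≃-refl {ℚᵘ.mkℚᵘ (+ 1) 0}) (ℚᵘ.≃-sym (ℚ.toℚᵘ-fromℚᵘ (ℚᵘ.mkℚᵘ (+ n) 0))))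
    (ℚᵘ.≃-sym (ℚ.toℚᵘ-homo-+ 1ℚ (ι n))))))

ι-+ : ∀ m n → ι (m ℕ.+ n) ≡ ι m + ι n
ι-+ zero    n = sym (ℚ.+-identityˡ (ι n))
ι-+ (suc m) n = trans (ι-suc (m ℕ.+ n)) (trans (cong (λ t → 1ℚ + t) (ι-+ m n))
  (trans (sym (ℚ.+-assoc 1ℚ (ι m) (ι n))) (cong (_+ ι n) (sym (ι-suc m)))))

ι-* : ∀ m n → ι (m ℕ.* n) ≡ ι m * ι n
ι-* zero    n = sym (ℚ.*-zeroˡ (ι n))
ι-* (suc m) n = trans (ι-+ n (m ℕ.* n)) (trans (cong (λ t → ι n + t) (ι-* m n))
  (trans (solve 2 (λ a b → b :+ a :* b := (con 1ℚ :+ a) :* b) refl (ι m) (ι n))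
    (cong (_* ι n) (sym (ι-suc m)))))

ι-nonNeg : ∀ n → 0ℚ ≤ ι n
ι-nonNeg zero    = ℚ.≤-refl
ι-nonNeg (suc n) = subst (0ℚ ≤_) (sym (ι-suc n)) (+-nonNeg 0≤1 (ι-nonNeg n))

ι-pos : ∀ n .{{_ : ℕ.NonZero n}} → 0ℚ < ι n
ι-pos (suc n) = subst (0ℚ <_) (sym (ι-suc n)) (ℚ.+-mono-<-≤ 0<1 (ι-nonNeg n))

-- Finite sums over lists and Cauchy-Schwarz.

module _ {A : Set} where

  ∑ : List A → (A → ℚ) → ℚ
  ∑ []       f = 0ℚ
  ∑ (x ∷ xs) f = f x + ∑ xs f

  ∑-cong : ∀ xs {f g : A → ℚ} → (∀ {x} → x ∈ xs → f x ≡ g x) → ∑ xs f ≡ ∑ xs g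
  ∑-cong []       eq = refl
  ∑-cong (x ∷ xs) eq = cong₂ _+_ (eq (here refl)) (∑-cong xs (eq ∘ there))

  ∑-mono : ∀ xs {f g : A → ℚ} → (∀ {x} → x ∈ xs → f x ≤ g x) → ∑ xs f ≤ ∑ xs g
  ∑-mono []       le = ℚ.≤-refl
  ∑-mono (x ∷ xs) le = ℚ.+-mono-≤ (le (here refl)) (∑-mono xs (le ∘ there))

  ∑-zero : ∀ xs → ∑ xs (λ _ → 0ℚ) ≡ 0ℚ
  ∑-zero []       = refl
  ∑-zero (x ∷ xs) = trans (ℚ.+-identityˡ _) (∑-zero xs)

  ∑-const : ∀ xs c → ∑ xs (λ _ → c) ≡ ι (length xs) * c
  ∑-const []       c = sym (ℚ.*-zeroˡ c)
  ∑-const (x ∷ xs) c = trans (cong (λ t → c + t) (∑-const xs c))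
    (trans (solve 2 (λ l c → c :+ l :* c := (con 1ℚ :+ l) :* c) refl (ι (length xs)) c)
      (cong (_* c) (sym (ι-suc (length xs)))))

  ∑-nonNeg : ∀ xs {f : A → ℚ} → (∀ {x} → x ∈ xs → 0ℚ ≤ f x) → 0ℚ ≤ ∑ xs f
  ∑-nonNeg xs {f} 0≤f = subst (_≤ ∑ xs f) (∑-zero xs) (∑-mono xs 0≤f)

  ≤∑ : ∀ {xs} {f : A → ℚ} {x} → x ∈ xs → (∀ {x} → x ∈ xs → 0ℚ ≤ f x) → f x ≤ ∑ xs f
  ≤∑ {_ ∷ xs}         (here refl) 0≤f = ≤-from-difference (∑-nonNeg xs (0≤f ∘ there)) refl
  ≤∑ {y ∷ xs} {f} {x} (there x∈)  0≤f = subst (_≤ f y + ∑ xs f) (ℚ.+-identityˡ (f x))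
    (ℚ.+-mono-≤ (0≤f (here refl)) (≤∑ x∈ (0≤f ∘ there)))

  ∑-pos : ∀ {xs} {f : A → ℚ} {x} → x ∈ xs → 0ℚ < f x → (∀ {x} → x ∈ xs → 0ℚ ≤ f x) → 0ℚ < ∑ xs f
  ∑-pos {_ ∷ xs} (here refl) 0<fx 0≤f = ℚ.+-mono-<-≤ 0<fx (∑-nonNeg xs (0≤f ∘ there))
  ∑-pos          (there x∈)  0<fx 0≤f = ℚ.+-mono-≤-< (0≤f (here refl)) (∑-pos x∈ 0<fx (0≤f ∘ there))

  ∑-+ : ∀ xs (f g : A → ℚ) → ∑ xs (λ x → f x + g x) ≡ ∑ xs f + ∑ xs g
  ∑-+ []       f g = refl
  ∑-+ (x ∷ xs) f g = trans (cong (λ t → f x + g x + t) (∑-+ xs f g))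
    (solve 4 (λ a b c d → (a :+ b) :+ (c :+ d) := (a :+ c) :+ (b :+ d)) refl
      (f x) (g x) (∑ xs f) (∑ xs g))

  ∑-*ˡ : ∀ xs c (f : A → ℚ) → ∑ xs (λ x → c * f x) ≡ c * ∑ xs f
  ∑-*ˡ []       c f = sym (ℚ.*-zeroʳ c)
  ∑-*ˡ (x ∷ xs) c f = trans (cong (λ t → c * f x + t) (∑-*ˡ xs c f)) (sym (ℚ.*-distribˡ-+ c (f x) (∑ xs f)))

  ∑-++ : ∀ xs ys (f : A → ℚ) → ∑ (xs ++ ys) f ≡ ∑ xs f + ∑ ys f
  ∑-++ []       ys f = sym (ℚ.+-identityˡ _)
  ∑-++ (x ∷ xs) ys f = trans (cong (λ t → f x + t) (∑-++ xs ys f)) (sym (ℚ.+-assoc (f x) _ _))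

  module _ {P : U.Pred A 0ℓ} (P? : U.Decidable P) where

    ∑-partition : ∀ xs (f : A → ℚ) → ∑ xs f ≡ ∑ (filter P? xs) f + ∑ (filter (¬? ∘ P?) xs) f
    ∑-partition []       f = refl
    ∑-partition (x ∷ xs) f with P? x
    ... | yes _ = trans (cong (λ t → f x + t) (∑-partition xs f)) (sym (ℚ.+-assoc (f x) _ _))
    ... | no  _ = trans (cong (λ t → f x + t) (∑-partition xs f))
      (solve 3 (λ a b c → a :+ (b :+ c) := b :+ (a :+ c)) refl
        (f x) (∑ (filter P? xs) f) (∑ (filter (¬? ∘ P?) xs) f))

module _ {A B : Set} where

  ∑-map : ∀ (g : A → B) xs (f : B → ℚ) → ∑ (map g xs) f ≡ ∑ xs (f ∘ g)
  ∑-map g []       f = refl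
  ∑-map g (x ∷ xs) f = cong (λ t → f (g x) + t) (∑-map g xs f)

  ∑-concatMap : ∀ (g : A → List B) xs (f : B → ℚ) →
                ∑ (concatMap g xs) f ≡ ∑ xs (λ x → ∑ (g x) f)
  ∑-concatMap g []       f = refl
  ∑-concatMap g (x ∷ xs) f = trans (∑-++ (g x) (concatMap g xs) f)
    (cong (λ t → ∑ (g x) f + t) (∑-concatMap g xs f))

  ∑-swap : ∀ xs ys (f : A → B → ℚ) →
           ∑ xs (λ x → ∑ ys (f x)) ≡ ∑ ys (λ y → ∑ xs (λ x → f x y))
  ∑-swap []       ys f = sym (∑-zero ys)
  ∑-swap (x ∷ xs) ys f = trans (cong (λ t → ∑ ys (f x) + t) (∑-swap xs ys f))
    (sym (∑-+ ys (f x) (λ y → ∑ xs (λ x → f x y))))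

-- Cauchy–Schwarz (∑ w)² ≤ (∑ w² b)(∑ y) for b ≥ 1/y, with t = w² b; the
-- hypothesis is the tangent-line form of b ≥ 1/y.
cauchy : ∀ {A : Set} (xs : List A) (w t y : A → ℚ) →
         (∀ {x} → x ∈ xs → ∀ μ → μ * w x + μ * w x ≤ t x + μ * μ * y x) →
         0ℚ < ∑ xs y → ∑ xs w * ∑ xs w ≤ ∑ xs t * ∑ xs y
cauchy xs w t y tangents 0<Y with reciprocal 0<Y
... | i , 0<i , iY≡1 = ≤-from-difference (*-nonNeg (ℚ.<⇒≤ 0<Y) (≤⇒0≤- summed)) eq
  where
  W Y T μ : ℚ
  W = ∑ xs w
  Y = ∑ xs y
  T = ∑ xs t
  -- This is W / Y, the slope at which the summed tangent inequality 2μW ≤ T + μ²Y becomes W² / Y ≤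
  -- T.
  μ = W * i
  lhs : ∑ xs (λ x → μ * w x + μ * w x) ≡ μ * W + μ * W
  lhs = trans (∑-+ xs _ _) (cong₂ _+_ (∑-*ˡ xs μ w) (∑-*ˡ xs μ w))
  rhs : ∑ xs (λ x → t x + μ * μ * y x) ≡ T + μ * μ * Y
  rhs = trans (∑-+ xs _ _) (cong (λ a → T + a) (∑-*ˡ xs (μ * μ) y))
  summed : μ * W + μ * W ≤ T + μ * μ * Y
  summed = subst₂ _≤_ lhs rhs (∑-mono xs (λ x∈ → tangents x∈ μ))
  eq : W * W + Y * (T + μ * μ * Y - (μ * W + μ * W)) ≡ T * Y
  -- The surplus term W²(1 - iY)² of the identity vanishes because `i * Y` is 1.
  eq = trans (solve 4 (λ W Y T i →
                 W :* W :+ Y :* (T :+ (W :* i) :* (W :* i) :* Y :- ((W :* i) :* W :+ (W :* i) :* W))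
                 := T :* Y :+ W :* W :* ((con 1ℚ :- i :* Y) :* (con 1ℚ :- i :* Y))) refl W Y T i)
    (trans (cong (λ a → T * Y + W * W * ((1ℚ - a) * (1ℚ - a))) iY≡1)
      (solve 2 (λ a b → a :+ b :* ((con 1ℚ :- con 1ℚ) :* (con 1ℚ :- con 1ℚ)) := a) refl (T * Y) (W * W)))

-- After multiplication by `y` the two sides differ by w²(by - 1) + (w - μy)². Cancelling `y` is
-- allowed because y = 0 would contradict `1ℚ ≤ b * y`.
tangent : ∀ {w b y} → 0ℚ ≤ y → 1ℚ ≤ b * y → ∀ μ → μ * w + μ * w ≤ w * w * b + μ * μ * y
tangent {w} {b} {y} 0≤y 1≤by μ = ℚ.*-cancelˡ-≤-pos y {{ℚ.positive 0<y}}
  (≤-from-difference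
    (+-nonNeg (*-nonNeg (square-nonNeg w) (≤⇒0≤- 1≤by)) (square-nonNeg (w - μ * y)))
    (solve 4 (λ w b y μ → y :* (μ :* w :+ μ :* w) :+ (w :* w :* (b :* y :- con 1ℚ) :+ (w :- μ :* y) :* (w :- μ :* y))
      := y :* (w :* w :* b :+ μ :* μ :* y)) refl w b y μ))
  where
  0<y : 0ℚ < y
  0<y = ℚ.≰⇒> λ y≤0 → ℚ.<-irrefl refl (ℚ.<-≤-trans 0<1
    (subst (1ℚ ≤_) (trans (cong (b *_) (ℚ.≤-antisym y≤0 0≤y)) (ℚ.*-zeroʳ b)) 1≤by))

-- Indicators and sums split by a decidable predicate.

pick : {P : Set} → Dec P → ℚ → ℚ → ℚ
pick (yes _) a b = a
pick (no  _) a b = b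

pick-yes : ∀ {P : Set} (d : Dec P) {a b} → P → pick d a b ≡ a
pick-yes (yes _) _  = refl
pick-yes (no ¬p) pf = ⊥-elim (¬p pf)

pick-no : ∀ {P : Set} (d : Dec P) {a b} → ¬ P → pick d a b ≡ b
pick-no (yes pf) ¬p = ⊥-elim (¬p pf)
pick-no (no _)   _  = refl

𝟙 : {P : Set} → Dec P → ℚ
𝟙 d = pick d 1ℚ 0ℚ

𝟙-nonNeg : ∀ {P : Set} (d : Dec P) → 0ℚ ≤ 𝟙 d
𝟙-nonNeg (yes _) = 0≤1
𝟙-nonNeg (no  _) = ℚ.≤-refl

𝟙≤1 : ∀ {P : Set} (d : Dec P) → 𝟙 d ≤ 1ℚ
𝟙≤1 (yes _) = ℚ.≤-refl
𝟙≤1 (no  _) = 0≤1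

𝟙-mono : ∀ {P Q : Set} (d : Dec P) (e : Dec Q) → (P → Q) → 𝟙 d ≤ 𝟙 e
𝟙-mono (yes pf) e f = ℚ.≤-reflexive (sym (pick-yes e (f pf)))
𝟙-mono (no  _)  e f = 𝟙-nonNeg e

module _ {A : Set} {P : U.Pred A 0ℓ} (P? : U.Decidable P) where

  ∑-filter : ∀ xs (f : A → ℚ) → ∑ (filter P? xs) f ≡ ∑ xs (λ x → pick (P? x) (f x) 0ℚ)
  ∑-filter []       f = refl
  ∑-filter (x ∷ xs) f with P? x
  ... | yes _ = cong (λ t → f x + t) (∑-filter xs f)
  ... | no  _ = trans (∑-filter xs f) (sym (ℚ.+-identityˡ _))

  ∑-𝟙 : ∀ xs c → ∑ xs (λ x → 𝟙 (P? x) * c) ≡ ι (length (filter P? xs)) * c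
  ∑-𝟙 []       c = sym (ℚ.*-zeroˡ c)
  ∑-𝟙 (x ∷ xs) c with P? x
  ... | yes _ = trans (cong₂ _+_ (ℚ.*-identityˡ c) (∑-𝟙 xs c))
    (trans (solve 2 (λ l c → c :+ l :* c := (con 1ℚ :+ l) :* c) refl (ι (length (filter P? xs))) c)
      (cong (_* c) (sym (ι-suc (length (filter P? xs))))))
  ... | no  _ = trans (cong₂ _+_ (ℚ.*-zeroˡ c) (∑-𝟙 xs c)) (ℚ.+-identityˡ _)

  ∑-pick : ∀ xs (f g : A → ℚ) →
    ∑ xs (λ x → pick (P? x) (f x) (g x)) ≡ ∑ (filter P? xs) f + ∑ (filter (¬? ∘ P?) xs) g
  ∑-pick xs f g = trans (∑-partition P? xs _) (cong₂ _+_
    (∑-cong (filter P? xs) (λ {x} x∈ → pick-yes (P? x) (proj₂ (∈-filter⁻ P? {xs = xs} x∈))))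
    (∑-cong (filter (¬? ∘ P?) xs) (λ {x} x∈ → pick-no (P? x) (proj₂ (∈-filter⁻ (¬? ∘ P?) {xs = xs} x∈)))))

  length-partition : ∀ xs → length xs ≡ length (filter P? xs) ℕ.+ length (filter (¬? ∘ P?) xs)
  length-partition []       = refl
  length-partition (x ∷ xs) with P? x
  ... | yes _ = cong suc (length-partition xs)
  ... | no  _ = trans (cong suc (length-partition xs)) (sym (ℕ.+-suc _ _))

  filter-comm : ∀ {Q : U.Pred A 0ℓ} (Q? : U.Decidable Q) xs →
                filter P? (filter Q? xs) ≡ filter Q? (filter P? xs)
  filter-comm Q? []       = refl
  filter-comm Q? (x ∷ xs) with P? x in eqP | Q? x in eqQ
  ... | yes _ | yes _ rewrite eqP | eqQ = cong (x ∷_) (filter-comm Q? xs)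
  ... | yes _ | no  _ rewrite eqQ = filter-comm Q? xs
  ... | no  _ | yes _ rewrite eqP = filter-comm Q? xs
  ... | no  _ | no  _ = filter-comm Q? xs

-- Expectation over a uniformly random ordering.

module _ {A : Set} where

  -- A pair consists of a possible first entry of an ordering and the entries left to order after
  -- it.
  select : List A → List (A × List A)
  select []       = []
  select (x ∷ xs) = (x , xs) ∷ map (λ (y , ys) → y , x ∷ ys) (select xs)

  select-↭ : ∀ {xs y ys} → (y , ys) ∈ select xs → xs ↭ y ∷ ys
  select-↭ {x ∷ xs} (here refl) = ↭-refl
  select-↭ {x ∷ xs} (there p) with ∈-map⁻ _ p
  ... | (y , ys) , q , refl = ↭-trans (prep x (select-↭ q)) (swap x y ↭-refl)

  ∑-select : ∀ xs (f : A → ℚ) → ∑ (select xs) (f ∘ proj₁) ≡ ∑ xs f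
  ∑-select []       f = refl
  ∑-select (x ∷ xs) f = cong (λ t → f x + t)
    (trans (∑-map _ (select xs) (f ∘ proj₁)) (∑-select xs f))

  length-select : ∀ {x : A} {xs y ys} → (y , ys) ∈ select (x ∷ xs) → length ys ≡ length xs
  length-select                 (here refl) = refl
  length-select {xs = x′ ∷ xs} (there p) with ∈-map⁻ _ p
  ... | (y , ys) , q , refl = cong suc (length-select {x = x′} q)

  -- `permutations` inserts the head of the list, whereas the process reads an ordering from its
  -- front; this regroups the orderings by first entry. `x` lands either in front or behind the
  -- first entry of the shorter ordering, and in the second case recursion chooses that entry.
  ∑-permutations : ∀ x xs (f : List A → ℚ) → ∑ (permutations (x ∷ xs)) f ≡
    ∑ (select (x ∷ xs)) (λ (y , ys) → ∑ (permutations ys) (f ∘ (y ∷_)))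
  ∑-permutations x xs f = begin
    ∑ (permutations (x ∷ xs)) f
      ≡⟨ ∑-concatMap (insertions x) (permutations xs) f ⟩
    ∑ (permutations xs) (λ σ → ∑ (insertions x σ) f)
      ≡⟨ ∑-cong (permutations xs) (λ {σ} _ → split σ) ⟩
    ∑ (permutations xs) (λ σ → f (x ∷ σ) + later σ)
      ≡⟨ ∑-+ (permutations xs) (f ∘ (x ∷_)) later ⟩
    ∑ (permutations xs) (f ∘ (x ∷_)) + ∑ (permutations xs) later
      ≡⟨ cong (λ t → ∑ (permutations xs) (f ∘ (x ∷_)) + t) (trans (recurse xs) (sym (∑-map _ (select xs) _))) ⟩
    ∑ (select (x ∷ xs)) (λ (y , ys) → ∑ (permutations ys) (f ∘ (y ∷_))) ∎
    where
    open ≡-Reasoning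
    -- The insertions of `x` that leave the first entry in place; an empty ordering has none.
    later : List A → ℚ
    later []      = 0ℚ
    later (y ∷ σ) = ∑ (insertions x σ) (f ∘ (y ∷_))
    split : ∀ σ → ∑ (insertions x σ) f ≡ f (x ∷ σ) + later σ
    split []      = refl
    split (y ∷ σ) = cong (λ t → f (x ∷ y ∷ σ) + t) (∑-map (y ∷_) (insertions x σ) f)
    recurse : ∀ xs → ∑ (permutations xs) later ≡
           ∑ (select xs) (λ (y , ys) → ∑ (permutations (x ∷ ys)) (f ∘ (y ∷_)))
    recurse []       = refl
    recurse (z ∷ zs) = trans (∑-permutations z zs later) (∑-cong (select (z ∷ zs))
      (λ {(y , ys)} _ → sym (∑-concatMap (insertions x) (permutations ys) (f ∘ (y ∷_)))))

  𝔼 : List A → (List A → ℚ) → ℚ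
  𝔼 xs f = (+ 1 / length xs !) {{length xs ℕ.!≢0}} * ∑ (permutations xs) f

  private
    1/! : ℕ → ℚ
    1/! n = (+ 1 / n !) {{n ℕ.!≢0}}

    0<1/! : ∀ n → 0ℚ < 1/! n
    0<1/! n = ℚ.positive⁻¹ (1/! n) {{ℚ.normalize-pos 1 (n !) {{n ℕ.!≢0}}}}

    !-pos : ∀ n → 0ℚ < ι (n !)
    !-pos n = ι-pos (n !) {{n ℕ.!≢0}}

    1/!-suc : ∀ n → ι (suc n) * 1/! (suc n) ≡ 1/! n
    1/!-suc n = *-cancelˡ (!-pos n) (begin
      ι (n !) * (ι (suc n) * 1/! (suc n))
        ≡⟨ solve 3 (λ a b c → a :* (b :* c) := c :* (b :* a)) refl (ι (n !)) (ι (suc n)) (1/! (suc n)) ⟩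
      1/! (suc n) * (ι (suc n) * ι (n !))
        ≡⟨ cong (1/! (suc n) *_) (ι-* (suc n) (n !)) ⟨
      1/! (suc n) * ι (suc n !)
        ≡⟨ /-* 1 (suc n !) {{suc n ℕ.!≢0}} ⟩
      1ℚ
        ≡⟨ /-* 1 (n !) {{n ℕ.!≢0}} ⟨
      1/! n * ι (n !)
        ≡⟨ ℚ.*-comm (1/! n) (ι (n !)) ⟩
      ι (n !) * 1/! n ∎)
      where open ≡-Reasoning

  𝔼-mono : ∀ xs {f g : List A → ℚ} → (∀ {σ} → σ ∈ permutations xs → f σ ≤ g σ) → 𝔼 xs f ≤ 𝔼 xs g
  𝔼-mono xs le = *-mono-≤ (ℚ.<⇒≤ (0<1/! (length xs))) (∑-mono (permutations xs) le)

  !-𝔼 : ∀ xs f → ι (length xs !) * 𝔼 xs f ≡ ∑ (permutations xs) f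
  !-𝔼 xs f = begin
    ι (k !) * (1/! k * ∑ (permutations xs) f)
      ≡⟨ solve 3 (λ a b c → a :* (b :* c) := b :* a :* c) refl (ι (k !)) (1/! k) (∑ (permutations xs) f) ⟩
    1/! k * ι (k !) * ∑ (permutations xs) f
      ≡⟨ cong (_* ∑ (permutations xs) f) (/-* 1 (k !) {{k ℕ.!≢0}}) ⟩
    1ℚ * ∑ (permutations xs) f
      ≡⟨ ℚ.*-identityˡ (∑ (permutations xs) f) ⟩
    ∑ (permutations xs) f ∎
    where
    open ≡-Reasoning
    k : ℕ
    k = length xs

  𝔼-const : ∀ xs c → 𝔼 xs (λ _ → c) ≡ c
  𝔼-const xs c = *-cancelˡ (!-pos (length xs)) (trans (!-𝔼 xs (λ _ → c))
    (trans (∑-const (permutations xs) c) (cong (λ k → ι k * c) (length-permutations xs))))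

  -- Given the first entry `y`, the rest of a uniform ordering is a uniform ordering of what is
  -- left. The factor `length xs` clears the probability of each first entry.
  𝔼-first : ∀ xs (f : List A → ℚ) →
            ι (length xs) * 𝔼 xs f ≡ ∑ (select xs) (λ (y , ys) → 𝔼 ys (f ∘ (y ∷_)))
  𝔼-first []       f = ℚ.*-zeroˡ (𝔼 [] f)
  𝔼-first (x ∷ xs) f = begin
    ι (suc m) * (1/! (suc m) * ∑ (permutations (x ∷ xs)) f)
      ≡⟨ ℚ.*-assoc (ι (suc m)) (1/! (suc m)) (∑ (permutations (x ∷ xs)) f) ⟨
    ι (suc m) * 1/! (suc m) * ∑ (permutations (x ∷ xs)) f
      ≡⟨ cong₂ _*_ (1/!-suc m) (∑-permutations x xs f) ⟩
    1/! m * ∑ (select (x ∷ xs)) (λ (y , ys) → ∑ (permutations ys) (f ∘ (y ∷_)))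
      ≡⟨ ∑-*ˡ (select (x ∷ xs)) (1/! m) (λ (y , ys) → ∑ (permutations ys) (f ∘ (y ∷_))) ⟨
    ∑ (select (x ∷ xs)) (λ (y , ys) → 1/! m * ∑ (permutations ys) (f ∘ (y ∷_)))
      ≡⟨ ∑-cong (select (x ∷ xs)) (λ {(y , ys)} p →
           cong (λ k → 1/! k * ∑ (permutations ys) (f ∘ (y ∷_))) (sym (length-select {x = x} p))) ⟩
    ∑ (select (x ∷ xs)) (λ (y , ys) → 𝔼 ys (f ∘ (y ∷_))) ∎
    where
    open ≡-Reasoning
    m : ℕ
    m = length xs

  module _ {P : U.Pred A 0ℓ} (P? : U.Decidable P) where

    filter-select : ∀ {xs y ys} → (y , ys) ∈ select xs → ¬ P y → filter P? ys ≡ filter P? xs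
    filter-select {x ∷ xs} (here refl) ¬Py = sym (filter-reject P? ¬Py)
    filter-select {x ∷ xs} (there p) ¬Py with ∈-map⁻ _ p
    ... | _ , q , refl with P? x
    ... | yes _ = cong (x ∷_) (filter-select q ¬Py)
    ... | no  _ = filter-select q ¬Py

    private
      split : (A → List A → ℚ) → ℚ → A × List A → ℚ
      split f c (y , ys) with P? y
      ... | yes _ = f y (filter P? ys)
      ... | no  _ = c

    -- Each entry outside `P` contributes `c`. Their number is a difference of two lengths, whose
    -- terms are added on opposite sides to avoid a subtraction.
    ∑-select-filter : ∀ xs (f : A → List A → ℚ) c →
      ∑ (select xs) (split f c) + ι (length (filter P? xs)) * c ≡
      ∑ (select (filter P? xs)) (λ (y , ys) → f y ys) + ι (length xs) * c
    ∑-select-filter []       f c = refl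
    ∑-select-filter (x ∷ xs) f c with P? x in eq
    ... | yes _ = begin
      f x xs′ + ∑ (map _ (select xs)) (split f c) + ι (suc (length xs′)) * c
        ≡⟨ cong₂ (λ s t → f x xs′ + s + t * c) (trans (∑-map _ (select xs) (split f c)) (∑-cong (select xs) (λ {z} _ → shift z))) (ι-suc (length xs′)) ⟩
      f x xs′ + ∑ (select xs) (split f′ c) + (1ℚ + ι (length xs′)) * c
        ≡⟨ solve 4 (λ a b l c → a :+ b :+ (con 1ℚ :+ l) :* c := a :+ c :+ (b :+ l :* c)) refl
             (f x xs′) (∑ (select xs) (split f′ c)) (ι (length xs′)) c ⟩
      f x xs′ + c + (∑ (select xs) (split f′ c) + ι (length xs′) * c)
        ≡⟨ cong (λ t → f x xs′ + c + t) (∑-select-filter xs f′ c) ⟩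
      f x xs′ + c + (∑ (select xs′) (λ (y , ys) → f′ y ys) + ι (length xs) * c)
        ≡⟨ solve 4 (λ a b l c → a :+ c :+ (b :+ l :* c) := a :+ b :+ (con 1ℚ :+ l) :* c) refl
             (f x xs′) (∑ (select xs′) (λ (y , ys) → f′ y ys)) (ι (length xs)) c ⟩
      f x xs′ + ∑ (select xs′) (λ (y , ys) → f′ y ys) + (1ℚ + ι (length xs)) * c
        ≡⟨ cong₂ (λ s t → f x xs′ + s + t * c) (∑-map _ (select xs′) (λ (y , ys) → f y ys)) (ι-suc (length xs)) ⟨
      f x xs′ + ∑ (map _ (select xs′)) (λ (y , ys) → f y ys) + ι (suc (length xs)) * c ∎
      where
      open ≡-Reasoning
      xs′ : List A
      xs′ = filter P? xs
      f′ : A → List A → ℚ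
      f′ y ys = f y (x ∷ ys)
      shift : ∀ z → split f c (proj₁ z , x ∷ proj₂ z) ≡ split f′ c z
      shift (y , ys) with P? y
      ... | yes _ rewrite eq = refl
      ... | no  _ = refl
    ... | no _ = begin
      c + ∑ (map _ (select xs)) (split f c) + ι (length xs′) * c
        ≡⟨ cong (λ s → c + s + ι (length xs′) * c) (trans (∑-map _ (select xs) (split f c)) (∑-cong (select xs) (λ {z} _ → shift z))) ⟩
      c + ∑ (select xs) (split f c) + ι (length xs′) * c
        ≡⟨ ℚ.+-assoc c _ _ ⟩
      c + (∑ (select xs) (split f c) + ι (length xs′) * c)
        ≡⟨ cong (λ t → c + t) (∑-select-filter xs f c) ⟩
      c + (∑ (select xs′) (λ (y , ys) → f y ys) + ι (length xs) * c)
        ≡⟨ solve 3 (λ b l c → c :+ (b :+ l :* c) := b :+ (con 1ℚ :+ l) :* c) refl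
             (∑ (select xs′) (λ (y , ys) → f y ys)) (ι (length xs)) c ⟩
      ∑ (select xs′) (λ (y , ys) → f y ys) + (1ℚ + ι (length xs)) * c
        ≡⟨ cong (λ t → ∑ (select xs′) (λ (y , ys) → f y ys) + t * c) (ι-suc (length xs)) ⟨
      ∑ (select xs′) (λ (y , ys) → f y ys) + ι (suc (length xs)) * c ∎
      where
      open ≡-Reasoning
      xs′ : List A
      xs′ = filter P? xs
      shift : ∀ z → split f c (proj₁ z , x ∷ proj₂ z) ≡ split f c z
      shift (y , ys) with P? y
      ... | yes _ rewrite eq = refl
      ... | no  _ = refl

    -- Condition on the first entry: if it satisfies `P`, it is also first after filtering;
    -- otherwise filtering forgets it and the expectation over the filtered list remains. With a of
    -- l entries kept, this reads l 𝔼 = a c + (l - a) c. It lets the process after a pivot be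
    -- studied on the surviving set alone.
    𝔼-filter : ∀ xs (f : List A → ℚ) → 𝔼 xs (f ∘ filter P?) ≡ 𝔼 (filter P? xs) f
    𝔼-filter xs f = go (length xs) xs refl f
      where
      open ≡-Reasoning
      go : ∀ m xs → length xs ≡ m → ∀ f → 𝔼 xs (f ∘ filter P?) ≡ 𝔼 (filter P? xs) f
      go zero    []       _   f = refl
      go (suc m) (x ∷ xs) len f = *-cancelˡ (ι-pos (suc (length xs))) (begin
        ι l * 𝔼 L (f ∘ filter P?)
          ≡⟨ 𝔼-first L (f ∘ filter P?) ⟩
        ∑ (select L) (λ (y , ys) → 𝔼 ys (f ∘ filter P? ∘ (y ∷_)))
          ≡⟨ ∑-cong (select L) (λ {z} → cases z) ⟩
        ∑ (select L) (split g c)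
          ≡⟨ solve 2 (λ a b → a := a :+ b :- b) refl (∑ (select L) (split g c)) (ι (length F) * c) ⟩
        ∑ (select L) (split g c) + ι (length F) * c - ι (length F) * c
          ≡⟨ cong (_- ι (length F) * c) (∑-select-filter L g c) ⟩
        ∑ (select F) (λ (y , ys) → g y ys) + ι l * c - ι (length F) * c
          ≡⟨ cong (λ t → t + ι l * c - ι (length F) * c) (𝔼-first F f) ⟨
        ι (length F) * c + ι l * c - ι (length F) * c
          ≡⟨ solve 2 (λ a b → a :+ b :- a := b) refl (ι (length F) * c) (ι l * c) ⟩
        ι l * c ∎)
        where
        L F : List A
        L = x ∷ xs
        F = filter P? L
        l : ℕ
        l = length L
        c : ℚ
        c = 𝔼 F f
        g : A → List A → ℚ
        g y ys = 𝔼 ys (f ∘ (y ∷_))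
        shorter : ∀ {y ys} → (y , ys) ∈ select L → length ys ≡ m
        shorter p = trans (length-select {x = x} p) (ℕ.suc-injective len)
        cases : ∀ z → z ∈ select L → 𝔼 (proj₂ z) (f ∘ filter P? ∘ (proj₁ z ∷_)) ≡ split g c z
        cases (y , ys) p with P? y
        ... | yes _  = go m ys (shorter p) (f ∘ (y ∷_))
        ... | no ¬Py = trans (go m ys (shorter p) f) (cong (λ zs → 𝔼 zs f) (filter-select p ¬Py))

-- The weights c_u and the quadratic estimate.

∈⇒length-pos : ∀ {A : Set} {x : A} {xs} → x ∈ xs → 0 ℕ.< length xs
∈⇒length-pos (here _)  = ℕ.z<s
∈⇒length-pos (there _) = ℕ.z<s

-- c_u = h (ω u) with h decreasing, so that min(c_x, c_u) = h (ω x ⊔ ω u).  The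
-- recursion for h says that h-balance at k and at k + 1 are the same equation,
-- r k being the number of x ∈ K with ω x ≤ k.
module Weights {A : Set} (ω : A → ℕ) (K : List A) {z : A} (z∈K : z ∈ K) (ωz≡0 : ω z ≡ 0) where

  private
    r : ℕ → ℕ
    r k = length (filter (λ x → ω x ℕ.≤? k) K)

    -- The entry `z` is counted for every `k`, which keeps the factor `r k + k` in the recursion for
    -- `h` positive even at 0.
    0<r : ∀ k → 0 ℕ.< r k
    0<r k = ∈⇒length-pos (∈-filter⁺ (λ x → ω x ℕ.≤? k) z∈K (subst (ℕ._≤ k) (sym ωz≡0) ℕ.z≤n))

  abstract
    h : ℕ → ℚ
    h zero    = 1ℚ
    h (suc k) = h k * ((+ 1 / suc (r k ℕ.+ k)) * ι (r k ℕ.+ k))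

    h-step : ∀ k → ι (suc (r k ℕ.+ k)) * h (suc k) ≡ ι (r k ℕ.+ k) * h k
    h-step k = trans
      (solve 4 (λ n h i m → n :* (h :* (i :* m)) := i :* n :* (m :* h)) refl
        (ι (suc (r k ℕ.+ k))) (h k) (+ 1 / suc (r k ℕ.+ k)) (ι (r k ℕ.+ k)))
      (trans (cong (_* (ι (r k ℕ.+ k) * h k)) (/-* 1 (suc (r k ℕ.+ k))))
        (ℚ.*-identityˡ (ι (r k ℕ.+ k) * h k)))

    h-pos : ∀ k → 0ℚ < h k
    h-pos zero    = 0<1
    h-pos (suc k) = *-pos (h-pos k) (*-pos
      (ℚ.positive⁻¹ (+ 1 / suc (r k ℕ.+ k)) {{ℚ.normalize-pos 1 (suc (r k ℕ.+ k))}})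
      (ι-pos (r k ℕ.+ k) {{ℕ.>-nonZero (ℕ.≤-trans (0<r k) (ℕ.m≤m+n (r k) k))}}))

  h-nonNeg : ∀ k → 0ℚ ≤ h k
  h-nonNeg k = ℚ.<⇒≤ (h-pos k)

  private
    h-suc≤ : ∀ k → h (suc k) ≤ h k
    h-suc≤ k = ℚ.*-cancelˡ-≤-pos (ι (suc n)) {{ℚ.positive (ι-pos (suc n))}}
      (≤-from-difference (h-nonNeg k) (begin
        ι (suc n) * h (suc k) + h k  ≡⟨ cong (_+ h k) (h-step k) ⟩
        ι n * h k + h k              ≡⟨ solve 2 (λ n h → n :* h :+ h := (con 1ℚ :+ n) :* h) refl (ι n) (h k) ⟩
        (1ℚ + ι n) * h k             ≡⟨ cong (_* h k) (ι-suc n) ⟨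
        ι (suc n) * h k              ∎))
      where
      open ≡-Reasoning
      n : ℕ
      n = r k ℕ.+ k

  h-anti : ∀ {j k} → j ℕ.≤ k → h k ≤ h j
  h-anti j≤k = go (ℕ.≤⇒≤′ j≤k)
    where
    go : ∀ {j k} → j ℕ.≤′ k → h k ≤ h j
    go ℕ.≤′-refl       = ℚ.≤-refl
    go (ℕ.≤′-step {k} j≤k) = ℚ.≤-trans (h-suc≤ k) (go j≤k)

  s : ℚ
  s = ∑ K (h ∘ ω)

  s-pos : 0ℚ < s
  s-pos = ∑-pos z∈K (h-pos (ω z)) (λ {x} _ → h-nonNeg (ω x))

  -- Stated for all `k`, not only for values of `ω`, to allow induction. From `k` to `suc k` only
  -- the `r k` summands with `ω x ≤ k` change, from `h k` to `h (suc k)`, and `h-step` offsets this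
  -- against the first term.
  h-balance : ∀ k → ι k * h k + ∑ K (λ x → h (ω x ⊔ k)) ≡ s
  h-balance zero = trans (cong₂ _+_ (ℚ.*-zeroˡ (h 0))
      (∑-cong K (λ {x} _ → cong h (ℕ.⊔-identityʳ (ω x))))) (ℚ.+-identityˡ s)
  h-balance (suc k) = trans (begin
    ι (suc k) * h (suc k) + M′ K (suc k)
      ≡⟨ solve 4 (λ a b R c → a :* b :+ c := (R :+ a) :* b :+ (c :- R :* b)) refl
           (ι (suc k)) (h (suc k)) (ι (r k)) (M′ K (suc k)) ⟩
    (ι (r k) + ι (suc k)) * h (suc k) + (M′ K (suc k) - ι (r k) * h (suc k))
      ≡⟨ cong₂ _+_ (trans (cong (_* h (suc k)) (trans (sym (ι-+ (r k) (suc k))) (cong ι (ℕ.+-suc (r k) k))))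
           (trans (h-step k) (cong (_* h k) (ι-+ (r k) k)))) (difference K) ⟩
    (ι (r k) + ι k) * h k + (M′ K k - ι (r k) * h k)
      ≡⟨ solve 4 (λ a b R c → (R :+ a) :* b :+ (c :- R :* b) := a :* b :+ c) refl
           (ι k) (h k) (ι (r k)) (M′ K k) ⟩
    ι k * h k + M′ K k ∎) (h-balance k)
    where
    open ≡-Reasoning
    R : List A → ℕ
    R xs = length (filter (λ x → ω x ℕ.≤? k) xs)
    M′ : List A → ℕ → ℚ
    M′ xs j = ∑ xs (λ x → h (ω x ⊔ j))
    -- Both sides equal the sum of `h (ω x)` over the entries with ω x > k: the remaining entries
    -- contribute `h j` each, and these are subtracted.
    difference : ∀ xs → M′ xs (suc k) - ι (R xs) * h (suc k) ≡ M′ xs k - ι (R xs) * h k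
    difference []       = cong (λ t → 0ℚ - t) (trans (ℚ.*-zeroˡ (h (suc k))) (sym (ℚ.*-zeroˡ (h k))))
    difference (x ∷ xs) = cases (ω x ℕ.≤? k)
      where
      absorb : ∀ j → R (x ∷ xs) ≡ suc (R xs) → ω x ⊔ j ≡ j →
        h (ω x ⊔ j) + M′ xs j - ι (R (x ∷ xs)) * h j ≡ M′ xs j - ι (R xs) * h j
      absorb j eqR eq = trans
        (cong₂ (λ i l → h i + M′ xs j - l * h j) eq (trans (cong ι eqR) (ι-suc (R xs))))
        (solve 3 (λ a b R → a :+ b :- (con 1ℚ :+ R) :* a := b :- R :* a) refl (h j) (M′ xs j) (ι (R xs)))
      keep : ∀ j → R (x ∷ xs) ≡ R xs → ω x ⊔ j ≡ ω x →
        h (ω x ⊔ j) + M′ xs j - ι (R (x ∷ xs)) * h j ≡ h (ω x) + (M′ xs j - ι (R xs) * h j)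
      keep j eqR eq = trans (cong₂ (λ i l → h i + M′ xs j - ι l * h j) eq eqR)
        (ℚ.+-assoc (h (ω x)) (M′ xs j) (- (ι (R xs) * h j)))
      cases : Dec (ω x ℕ.≤ k) →
        M′ (x ∷ xs) (suc k) - ι (R (x ∷ xs)) * h (suc k) ≡ M′ (x ∷ xs) k - ι (R (x ∷ xs)) * h k
      cases (yes ωx≤k) = trans (absorb (suc k) eqR (ℕ.m≤n⇒m⊔n≡n (ℕ.m≤n⇒m≤1+n ωx≤k)))
        (trans (difference xs) (sym (absorb k eqR (ℕ.m≤n⇒m⊔n≡n ωx≤k))))
        where
        eqR : R (x ∷ xs) ≡ suc (R xs)
        eqR = cong length (filter-accept (λ x → ω x ℕ.≤? k) ωx≤k)
      cases (no ωx≰k) = trans (keep (suc k) eqR (ℕ.m≥n⇒m⊔n≡m (ℕ.≰⇒> ωx≰k)))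
        (trans (cong (λ t → h (ω x) + t) (difference xs)) (sym (keep k eqR (ℕ.m≥n⇒m⊔n≡m (ℕ.≰⇒≥ ωx≰k)))))
        where
        eqR : R (x ∷ xs) ≡ R xs
        eqR = cong length (filter-reject (λ x → ω x ℕ.≤? k) ωx≰k)

  m : A → A → ℚ
  m x u = h (ω x ⊔ ω u)

  private
    m-nonNeg : ∀ x u → 0ℚ ≤ m x u
    m-nonNeg x u = h-nonNeg (ω x ⊔ ω u)

    m-sym : ∀ x u → m x u ≡ m u x
    m-sym x u = cong h (ℕ.⊔-comm (ω x) (ω u))

    -- One of the two values is the minimum `m x u`, so (h (ω u) - m)(h (ω x) - m) = 0; this is the
    -- product expanded.
    m-exchange : ∀ x u → h (ω u) * m x u + h (ω x) * m x u ≡ h (ω u) * h (ω x) + m x u * m x u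
    m-exchange x u with ℕ.≤-total (ω x) (ω u)
    ... | inj₁ le rewrite ℕ.m≤n⇒m⊔n≡n le =
      solve 2 (λ a b → a :* a :+ b :* a := a :* b :+ a :* a) refl (h (ω u)) (h (ω x))
    ... | inj₂ ge rewrite ℕ.m≥n⇒m⊔n≡m ge = refl

  -- In row `x` the excess of `B` over 1 is at most `ω x` in total and carries weights at most
  -- `h (ω x)` squared, so it costs a second copy of `Ω`. Then `M + Ω + Ω` equals `s * s` by `Ω+N`
  -- and `N+N`.
  energy : ∀ (B : A → A → ℚ) → (∀ {x u} → x ∈ K → u ∈ K → 1ℚ ≤ B x u) →
    (∀ {x} → x ∈ K → ∑ K (B x) ≤ ι (length K) + ι (ω x)) →
    ∑ K (λ u → ∑ K (λ x → m x u * m x u * B x u) + ι (ω u) * (h (ω u) * h (ω u))) ≤ s * s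
  energy B 1≤B rows = begin
    ∑ K (λ u → ∑ K (λ x → m x u * m x u * B x u) + ι (ω u) * (h (ω u) * h (ω u)))
      ≡⟨ ∑-+ K _ _ ⟩
    ∑ K (λ u → ∑ K (λ x → m x u * m x u * B x u)) + Ω
      ≡⟨ cong (_+ Ω) (∑-swap K K (λ u x → m x u * m x u * B x u)) ⟩
    ∑ K (λ x → ∑ K (λ u → m x u * m x u * B x u)) + Ω
      ≤⟨ ℚ.+-monoˡ-≤ Ω (∑-mono K row) ⟩
    ∑ K (λ x → ∑ K (λ u → m x u * m x u) + ι (ω x) * (h (ω x) * h (ω x))) + Ω
      ≡⟨ cong (_+ Ω) (∑-+ K _ _) ⟩
    M + Ω + Ω
      ≡⟨ solve 3 (λ M Ω N → M :+ Ω :+ Ω := (Ω :+ N) :+ (Ω :+ N) :- (N :+ N) :+ M) refl M Ω N ⟩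
    (Ω + N) + (Ω + N) - (N + N) + M
      ≡⟨ cong₂ (λ a b → a + a - b + M) Ω+N N+N ⟩
    s * s + s * s - (s * s + M) + M
      ≡⟨ solve 2 (λ a M → a :+ a :- (a :+ M) :+ M := a) refl (s * s) M ⟩
    s * s ∎
    where
    open ℚ.≤-Reasoning
    Ω M N : ℚ
    Ω = ∑ K (λ u → ι (ω u) * (h (ω u) * h (ω u)))
    M = ∑ K (λ x → ∑ K (λ u → m x u * m x u))
    N = ∑ K (λ u → ∑ K (λ x → h (ω u) * m x u))
    row : ∀ {x} → x ∈ K → ∑ K (λ u → m x u * m x u * B x u) ≤
      ∑ K (λ u → m x u * m x u) + ι (ω x) * (h (ω x) * h (ω x))
    row {x} x∈K = begin
      ∑ K (λ u → m x u * m x u * B x u)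
        ≤⟨ ∑-mono K entry ⟩
      ∑ K (λ u → m x u * m x u + H * (B x u - 1ℚ))
        ≡⟨ trans (∑-+ K _ _) (cong (λ t → ∑ K (λ u → m x u * m x u) + t) (trans (∑-*ˡ K H _)
             (cong (H *_) (trans (∑-+ K _ _) (cong (λ t → ∑ K (B x) + t) (∑-const K (- 1ℚ))))))) ⟩
      ∑ K (λ u → m x u * m x u) + H * (∑ K (B x) + ι (length K) * (- 1ℚ))
        ≤⟨ ℚ.+-monoʳ-≤ (∑ K (λ u → m x u * m x u)) (*-mono-≤ 0≤H
             (ℚ.+-monoˡ-≤ (ι (length K) * (- 1ℚ)) (rows x∈K))) ⟩
      ∑ K (λ u → m x u * m x u) + H * (ι (length K) + ι (ω x) + ι (length K) * (- 1ℚ))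
        ≡⟨ cong (λ t → ∑ K (λ u → m x u * m x u) + t)
             (solve 3 (λ H l o → H :* (l :+ o :+ l :* con (- 1ℚ)) := o :* H) refl H (ι (length K)) (ι (ω x))) ⟩
      ∑ K (λ u → m x u * m x u) + ι (ω x) * H ∎
      where
      H : ℚ
      H = h (ω x) * h (ω x)
      0≤H : 0ℚ ≤ H
      0≤H = square-nonNeg (h (ω x))
      -- The slack is (H - m²)(B - 1), a product of nonnegative factors.
      entry : ∀ {u} → u ∈ K → m x u * m x u * B x u ≤ m x u * m x u + H * (B x u - 1ℚ)
      entry {u} u∈K = ≤-from-difference
        (*-nonNeg (≤⇒0≤- mm≤H) (≤⇒0≤- (1≤B x∈K u∈K)))
        (solve 3 (λ mm H B → mm :* B :+ (H :- mm) :* (B :- con 1ℚ) := mm :+ H :* (B :- con 1ℚ)) refl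
          (m x u * m x u) H (B x u))
        where
        mm≤H : m x u * m x u ≤ H
        mm≤H = ℚ.≤-trans (*-mono-≤ (m-nonNeg x u) m≤h)
          (subst (_≤ H) (ℚ.*-comm (h (ω x)) (m x u)) (*-mono-≤ (h-nonNeg (ω x)) m≤h))
          where
          m≤h : m x u ≤ h (ω x)
          m≤h = h-anti (ℕ.m≤m⊔n (ω x) (ω u))
    -- `h-balance` at `ω u`, multiplied by `h (ω u)` and summed over `u`.
    Ω+N : Ω + N ≡ s * s
    Ω+N = trans (sym (∑-+ K _ _)) (trans (∑-cong K column) (∑-*ˡ K s (h ∘ ω)))
      where
      column : ∀ {u} → u ∈ K →
        ι (ω u) * (h (ω u) * h (ω u)) + ∑ K (λ x → h (ω u) * m x u) ≡ s * h (ω u)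
      column {u} _ = trans
        (cong (λ t → ι (ω u) * (h (ω u) * h (ω u)) + t) (∑-*ˡ K (h (ω u)) (λ x → m x u)))
        (trans (solve 3 (λ o h t → o :* (h :* h) :+ h :* t := (o :* h :+ t) :* h) refl
            (ι (ω u)) (h (ω u)) (∑ K (λ x → m x u)))
          (cong (_* h (ω u)) (h-balance (ω u))))
    -- Adding `N` to its transpose makes `m-exchange` applicable to every pair.
    N+N : N + N ≡ s * s + M
    N+N = begin-equality
      N + N
        ≡⟨ cong (λ t → N + t) (trans (∑-swap K K _)
             (∑-cong K (λ {u} _ → ∑-cong K (λ {x} _ → cong (h (ω x) *_) (m-sym u x))))) ⟩
      N + ∑ K (λ u → ∑ K (λ x → h (ω x) * m x u))
        ≡⟨ trans (∑-cong K (λ _ → ∑-+ K _ _)) (∑-+ K _ _) ⟨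
      ∑ K (λ u → ∑ K (λ x → h (ω u) * m x u + h (ω x) * m x u))
        ≡⟨ ∑-cong K (λ {u} _ → ∑-cong K (λ {x} _ → m-exchange x u)) ⟩
      ∑ K (λ u → ∑ K (λ x → h (ω u) * h (ω x) + m x u * m x u))
        ≡⟨ trans (∑-cong K (λ _ → ∑-+ K _ _)) (∑-+ K _ _) ⟩
      ∑ K (λ u → ∑ K (λ x → h (ω u) * h (ω x))) + ∑ K (λ u → ∑ K (λ x → m x u * m x u))
        ≡⟨ cong₂ _+_ (trans (∑-cong K (λ {u} _ → trans (∑-*ˡ K (h (ω u)) (h ∘ ω)) (ℚ.*-comm (h (ω u)) s)))
             (∑-*ˡ K s (h ∘ ω))) (∑-swap K K _) ⟩
      s * s + M ∎

-- The process after its first pivot.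

module Process {n} (G : Graph n) where

  step-∷ : ∀ x σ → step G (x ∷ σ) ≡ filter (adj? G x) σ
  step-∷ x σ = filter-reject (adj? G x) (adj-irrefl G refl)

  -- The first vertex is not its own neighbour, so what follows is the process on the ordering
  -- induced on its neighbours. Later events are transported along this index shift.
  S-suc : ∀ x σ i → S G (x ∷ σ) (suc i) ≡ S G (filter (adj? G x) σ) i
  S-suc x σ zero    = step-∷ x σ
  S-suc x σ (suc i) = cong (step G) (S-suc x σ i)

  IsPivot-∷ : ∀ {v} x σ → IsPivot G v (filter (adj? G x) σ) → IsPivot G v (x ∷ σ)
  IsPivot-∷ x σ (i , eq) rewrite sym (S-suc x σ i) = suc i , eq

  InBlock-∷ : ∀ {v} x σ i → InBlock G (filter (adj? G x) σ) i v → InBlock G (x ∷ σ) (suc i) v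
  InBlock-∷ {v} x σ i (v∈ , v∉) =
    subst (v ∈_) (sym (S-suc x σ i)) v∈ , v∉ ∘ subst (v ∈_) (S-suc x σ (suc i))

  DifferentBlocks-∷ : ∀ {u v} x σ → DifferentBlocks G u v (filter (adj? G x) σ) →
                      DifferentBlocks G u v (x ∷ σ)
  DifferentBlocks-∷ x σ (i , j , i≢j , bᵢ , bⱼ) =
    suc i , suc j , i≢j ∘ ℕ.suc-injective , InBlock-∷ x σ i bᵢ , InBlock-∷ x σ j bⱼ

  DifferentBlocks-sym : ∀ {u v} σ → DifferentBlocks G u v σ → DifferentBlocks G v u σ
  DifferentBlocks-sym σ (i , j , i≢j , bᵢ , bⱼ) = j , i , i≢j ∘ sym , bⱼ , bᵢ

  -- `u` drops out with the first pivot and lies in block 0, while `v` survives that step and lies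
  -- in a later block. The case `u ≡ x` is included.
  separated : ∀ {u v} x σ → u ∈ x ∷ σ → v ∈ x ∷ σ → ¬ Adj G x u → Adj G x v →
              DifferentBlocks G u v (x ∷ σ)
  separated x σ u∈ v∈ ¬xu xv with eventuallyInBlock G (x ∷ σ) 1 (∈-filter⁺ (adj? G x) v∈ xv)
  ... | j , 1≤j , b = 0 , j , (λ { refl → ℕ.<-irrefl refl 1≤j })
    , (u∈ , ¬xu ∘ proj₂ ∘ ∈-filter⁻ (adj? G x) {xs = x ∷ σ}) , b

-- Pivot and separation events at a fixed vertex.

module At {n} (G : Graph n) (v : Fin n) where

  open Process G
  open DecMembership (Fin._≟_ {n}) using (_∈?_)

  Near : Fin n → Set
  Near u = u ≡ v ⊎ Adj G v u

  near? : U.Decidable Near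
  near? u = (u Fin.≟ v) ⊎-dec adj? G v u

  -- One predicate holds both kinds of event, so that the term for `p` and the terms for `q` pass
  -- through the same induction.
  Wins : Fin n → List (Fin n) → Set
  Wins u σ = (u ≡ v × IsPivot G v σ) ⊎ (u ≢ v × DifferentBlocks G v u σ)

  wins? : ∀ u → U.Decidable (Wins u)
  wins? u σ = ((u Fin.≟ v) ×-dec IsPivot? G v σ) ⊎-dec (¬? (u Fin.≟ v) ×-dec DifferentBlocks? G v u σ)

  wins-v : ∀ {u} σ → Near u → u ∈ v ∷ σ → Wins u (v ∷ σ)
  wins-v σ (inj₁ u≡v) _  = inj₁ (u≡v , 0 , refl)
  wins-v σ (inj₂ vu)  u∈ = inj₂ ((λ u≡v → adj-irrefl G (sym u≡v) vu)
    , separated v σ (here refl) u∈ (adj-irrefl G refl) vu)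

  wins-v-only : ∀ {u} x σ → u ∈ x ∷ σ → v ∈ x ∷ σ → Adj G x v → ¬ Adj G x u → Wins u (x ∷ σ)
  wins-v-only x σ u∈ v∈ xv ¬xu = inj₂ ((λ { refl → ¬xu xv })
    , DifferentBlocks-sym (x ∷ σ) (separated x σ u∈ v∈ ¬xu xv))

  wins-u-only : ∀ {u} x σ → u ∈ x ∷ σ → v ∈ x ∷ σ → ¬ Adj G x v → Adj G x u → Wins u (x ∷ σ)
  wins-u-only x σ u∈ v∈ ¬xv xu = inj₂ ((λ { refl → ¬xv xu }) , separated x σ v∈ u∈ ¬xv xu)

  -- This direction gives lower bounds on `E`, which is what upper bounds on reciprocals require.
  wins-∷ : ∀ {u} x σ → Wins u (filter (adj? G x) σ) → Wins u (x ∷ σ)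
  wins-∷ x σ (inj₁ (u≡v , piv))  = inj₁ (u≡v , IsPivot-∷ x σ piv)
  wins-∷ x σ (inj₂ (u≢v , diff)) = inj₂ (u≢v , DifferentBlocks-∷ x σ diff)

  E : List (Fin n) → Fin n → ℚ
  E L u = 𝔼 L (𝟙 ∘ wins? u)

  E-nonNeg : ∀ L u → 0ℚ ≤ E L u
  E-nonNeg L u = subst (_≤ E L u) (𝔼-const L 0ℚ) (𝔼-mono L (λ {σ} _ → 𝟙-nonNeg (wins? u σ)))

  E≤1 : ∀ L u → E L u ≤ 1ℚ
  E≤1 L u = subst (E L u ≤_) (𝔼-const L 1ℚ) (𝔼-mono L (λ {σ} _ → 𝟙≤1 (wins? u σ)))

  K : List (Fin n) → List (Fin n)
  K L = filter near? L

  -- A u is an upper bound for 1/E_L(u), stated without a division.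
  record Bound (L : List (Fin n)) : Set where
    field
      A      : Fin n → ℚ
      1≤A    : ∀ {u} → u ∈ K L → 1ℚ ≤ A u
      1≤A*E  : ∀ {u} → u ∈ K L → 1ℚ ≤ A u * E L u
      total  : ∑ (K L) A ≤ ι (length L)

  -- The inductive step: conditioning on the first pivot.

  module Step (L : List (Fin n)) (v∈L : v ∈ L)
    (IH : ∀ x → x ∈ L → Adj G x v → Bound (filter (adj? G x) L)) where

    private
      L′ : Fin n → List (Fin n)
      L′ x = filter (adj? G x) L

      Kᶜ : List (Fin n)
      Kᶜ = filter (¬? ∘ near?) L

      ω : Fin n → ℕ
      ω u = length (filter (adj? G u) Kᶜ)

      v∈K : v ∈ K L
      v∈K = ∈-filter⁺ near? v∈L (inj₁ refl)

      -- All neighbours of `v` in `L` belong to `K L`. Hence `v` supplies the entry of value 0 that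
      -- `Weights` asks for.
      ωv≡0 : ω v ≡ 0
      ωv≡0 = cong length (filter-none (adj? G v)
        (All.tabulate λ x∈ vx → proj₂ (∈-filter⁻ (¬? ∘ near?) {xs = L} x∈) (inj₂ vx)))

      open Weights ω (K L) v∈K ωv≡0

      K⇒L : ∀ {u} → u ∈ K L → u ∈ L
      K⇒L = proj₁ ∘ ∈-filter⁻ near? {xs = L}

      K⇒near : ∀ {u} → u ∈ K L → Near u
      K⇒near = proj₂ ∘ ∈-filter⁻ near? {xs = L}

      -- Total in `x`, so that it can stand under a sum. For `x` in `L` the default 1 is never read,
      -- since `both` selects its argument only when `x` is adjacent to `v`.
      IHᵈ : ∀ x → Dec (x ∈ L) → Dec (Adj G x v) → Fin n → ℚ
      IHᵈ x (yes x∈) (yes xv) = Bound.A (IH x x∈ xv)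
      IHᵈ x _        _        = λ _ → 1ℚ

      A′ : Fin n → Fin n → ℚ
      A′ x = IHᵈ x (x ∈? L) (adj? G x v)

      IH′ : ∀ {x} → x ∈ L → Adj G x v → ∃ λ (b : Bound (L′ x)) → Bound.A b ≡ A′ x
      IH′ {x} x∈ xv with x ∈? L | adj? G x v
      ... | yes x∈′ | yes xv′ = IH x x∈′ xv′ , refl
      ... | no x∉   | _       = ⊥-elim (x∉ x∈)
      ... | yes _   | no ¬xv  = ⊥-elim (¬xv xv)

      -- Meant for `x` in `K L`: if such an `x` is not adjacent to both `u` and `v`, it is `v`
      -- itself or adjacent to `v` alone. As first pivot it then makes the event for `u` certain,
      -- hence the value 1.
      both : Fin n → Fin n → ℚ → ℚ
      both x u c = pick (adj? G x v) (pick (adj? G x u) c 1ℚ) 1ℚ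

      B y : Fin n → Fin n → ℚ
      B x u = both x u (A′ x u)
      y x u = both x u (E (L′ x) u)

      data Cases (x u : Fin n) : Set where
        common   : Adj G x v → Adj G x u → (∀ c → both x u c ≡ c) → Cases x u
        separate : ¬ (Adj G x v × Adj G x u) → (∀ c → both x u c ≡ 1ℚ) → Cases x u

      cases : ∀ x u → Cases x u
      cases x u with adj? G x v | adj? G x u
      ... | yes xv | yes xu = common xv xu (λ c → trans (pick-yes (adj? G x v) xv) (pick-yes (adj? G x u) xu))
      ... | yes xv | no ¬xu = separate (¬xu ∘ proj₂) (λ c → trans (pick-yes (adj? G x v) xv) (pick-no (adj? G x u) ¬xu))
      ... | no ¬xv | _      = separate (¬xv ∘ proj₁) (λ c → pick-no (adj? G x v) ¬xv)

      ∈K′ : ∀ {x u} → u ∈ K L → Adj G x u → u ∈ K (L′ x)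
      ∈K′ {x} u∈ xu = ∈-filter⁺ near? (∈-filter⁺ (adj? G x) (K⇒L u∈) xu) (K⇒near u∈)

      1≤B : ∀ {x u} → x ∈ K L → u ∈ K L → 1ℚ ≤ B x u
      1≤B {x} {u} x∈ u∈ with cases x u
      ... | separate _ eq = ℚ.≤-reflexive (sym (eq (A′ x u)))
      ... | common xv xu eq with IH′ (K⇒L x∈) xv
      ... | b , A≡ = subst (1ℚ ≤_) (trans (cong (λ f → f u) A≡) (sym (eq (A′ x u)))) (Bound.1≤A b (∈K′ u∈ xu))

      1≤B*y : ∀ {x u} → x ∈ K L → u ∈ K L → 1ℚ ≤ B x u * y x u
      1≤B*y {x} {u} x∈ u∈ with cases x u
      ... | separate _ eq = ℚ.≤-reflexive (sym (cong₂ _*_ (eq (A′ x u)) (eq (E (L′ x) u))))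
      ... | common xv xu eq with IH′ (K⇒L x∈) xv
      ... | b , A≡ = subst (1ℚ ≤_)
        (cong₂ _*_ (trans (cong (λ f → f u) A≡) (sym (eq (A′ x u)))) (sym (eq (E (L′ x) u))))
        (Bound.1≤A*E b (∈K′ u∈ xu))

      y-nonNeg : ∀ x u → 0ℚ ≤ y x u
      y-nonNeg x u with cases x u
      ... | separate _ eq = subst (0ℚ ≤_) (sym (eq (E (L′ x) u))) 0≤1
      ... | common _ _ eq = subst (0ℚ ≤_) (sym (eq (E (L′ x) u))) (E-nonNeg (L′ x) u)

      Kˣ : Fin n → List (Fin n)
      Kˣ x = filter (¬? ∘ adj? G x) (K L)

      -- The part of `L′ x` outside `K L` has `ω x` vertices; the part inside, together with `Kˣ x`,
      -- makes up `K L`.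
      count : ∀ x → length (L′ x) ℕ.+ length (Kˣ x) ≡ length (K L) ℕ.+ ω x
      count x = begin
        length (L′ x) ℕ.+ c
          ≡⟨ cong (ℕ._+ c) (length-partition near? (L′ x)) ⟩
        length (K (L′ x)) ℕ.+ length (filter (¬? ∘ near?) (L′ x)) ℕ.+ c
          ≡⟨ cong₂ (λ xs ys → length xs ℕ.+ length ys ℕ.+ c)
               (filter-comm near? (adj? G x) L) (filter-comm (¬? ∘ near?) (adj? G x) L) ⟩
        a ℕ.+ ω x ℕ.+ c    ≡⟨ ℕ.+-assoc a (ω x) c ⟩
        a ℕ.+ (ω x ℕ.+ c)  ≡⟨ cong (a ℕ.+_) (ℕ.+-comm (ω x) c) ⟩
        a ℕ.+ (c ℕ.+ ω x)  ≡⟨ ℕ.+-assoc a c (ω x) ⟨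
        a ℕ.+ c ℕ.+ ω x    ≡⟨ cong (ℕ._+ ω x) (length-partition (adj? G x) (K L)) ⟨
        length (K L) ℕ.+ ω x ∎
        where
        open ≡-Reasoning
        a c : ℕ
        a = length (filter (adj? G x) (K L))
        c = length (Kˣ x)

      -- The hypothesis for `L′ x` bounds the sum of the entries at neighbours of `x` by
      -- `length (L′ x)`; the other entries, indexed by `Kˣ x`, are 1, and `count` converts the
      -- total.
      rows : ∀ {x} → x ∈ K L → ∑ (K L) (B x) ≤ ι (length (K L)) + ι (ω x)
      rows {x} x∈ = go (adj? G x v)
        where
        open ℚ.≤-Reasoning
        go : Dec (Adj G x v) → ∑ (K L) (B x) ≤ ι (length (K L)) + ι (ω x)
        -- Within `K L` only `x ≡ v` reaches this case.
        go (no ¬xv) = begin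
          ∑ (K L) (B x)            ≡⟨ ∑-cong (K L) (λ _ → pick-no (adj? G x v) ¬xv) ⟩
          ∑ (K L) (λ _ → 1ℚ)       ≡⟨ trans (∑-const (K L) 1ℚ) (ℚ.*-identityʳ _) ⟩
          ι (length (K L))         ≤⟨ ≤-from-difference (ι-nonNeg (ω x)) refl ⟩
          ι (length (K L)) + ι (ω x) ∎
        go (yes xv) = row (IH′ (K⇒L x∈) xv)
          where
          row : (∃ λ (b : Bound (L′ x)) → Bound.A b ≡ A′ x) →
                ∑ (K L) (B x) ≤ ι (length (K L)) + ι (ω x)
          row (b , A≡) = begin
            ∑ (K L) (B x)
              ≡⟨ ∑-cong (K L) (λ _ → pick-yes (adj? G x v) xv) ⟩
            ∑ (K L) (λ u → pick (adj? G x u) (A′ x u) 1ℚ)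
              ≡⟨ ∑-pick (adj? G x) (K L) (A′ x) (λ _ → 1ℚ) ⟩
            ∑ (filter (adj? G x) (K L)) (A′ x) + ∑ (Kˣ x) (λ _ → 1ℚ)
              ≡⟨ cong₂ _+_ (cong₂ ∑ (filter-comm (adj? G x) near? L) (sym A≡))
                   (trans (∑-const (Kˣ x) 1ℚ) (ℚ.*-identityʳ _)) ⟩
            ∑ (K (L′ x)) (Bound.A b) + ι (length (Kˣ x))
              ≤⟨ ℚ.+-monoˡ-≤ (ι (length (Kˣ x))) (Bound.total b) ⟩
            ι (length (L′ x)) + ι (length (Kˣ x))
              ≡⟨ ι-+ (length (L′ x)) (length (Kˣ x)) ⟨
            ι (length (L′ x) ℕ.+ length (Kˣ x))
              ≡⟨ cong ι (count x) ⟩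
            ι (length (K L) ℕ.+ ω x)
              ≡⟨ ι-+ (length (K L)) (ω x) ⟩
            ι (length (K L)) + ι (ω x) ∎

      -- With `u` fixed and the first pivot `x` ranging over `L`, these are the three families for
      -- `cauchy`. `Y u x` is a lower bound for the conditional probability of `Wins u`; outside
      -- `K L` it is 1 if `x` is adjacent to `u`, since `x` then separates `u` from `v`, and 0
      -- otherwise.
      W T Y : Fin n → Fin n → ℚ
      W u x = pick (near? x) (m x u) (𝟙 (adj? G u x) * h (ω u))
      T u x = pick (near? x) (m x u * m x u * B x u) (𝟙 (adj? G u x) * (h (ω u) * h (ω u)))
      Y u x = pick (near? x) (y x u) (𝟙 (adj? G u x))

      -- This is `h-balance` at `ω u`. The total does not depend on `u`, so the bounds share the
      -- denominator s².
      ∑W : ∀ u → ∑ L (W u) ≡ s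
      ∑W u = trans (∑-pick near? L _ _) (trans
        (cong (λ t → ∑ (K L) (λ x → m x u) + t) (∑-𝟙 (adj? G u) Kᶜ (h (ω u))))
        (trans (ℚ.+-comm (∑ (K L) (λ x → m x u)) (ι (ω u) * h (ω u))) (h-balance (ω u))))

      ∑T : ∀ u → ∑ L (T u) ≡ ∑ (K L) (λ x → m x u * m x u * B x u) + ι (ω u) * (h (ω u) * h (ω u))
      ∑T u = trans (∑-pick near? L _ _)
        (cong (λ t → ∑ (K L) (λ x → m x u * m x u * B x u) + t) (∑-𝟙 (adj? G u) Kᶜ (h (ω u) * h (ω u))))

      Y-nonNeg : ∀ u x → 0ℚ ≤ Y u x
      Y-nonNeg u x with near? x
      ... | yes _ = y-nonNeg x u
      ... | no  _ = 𝟙-nonNeg (adj? G u x)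

      ∑Y-pos : ∀ u → 0ℚ < ∑ L (Y u)
      ∑Y-pos u = ∑-pos v∈L (subst (0ℚ <_) (sym eq) 0<1) (λ {x} _ → Y-nonNeg u x)
        where
        eq : Y u v ≡ 1ℚ
        eq = trans (pick-yes (near? v) (inj₁ refl)) (pick-no (adj? G v v) (adj-irrefl G refl))

      tangents : ∀ {u} → u ∈ K L → ∀ {x} → x ∈ L → ∀ μ →
        μ * W u x + μ * W u x ≤ T u x + μ * μ * Y u x
      tangents {u} u∈ {x} x∈ μ with near? x
      ... | yes nx = tangent (y-nonNeg x u) (1≤B*y (∈-filter⁺ near? x∈ nx) u∈) μ
      ... | no _ with adj? G u x
      -- Here the weight is `h (ω u)` and the reciprocal is 1, so the slack is a square.
      ... | yes _ = ≤-from-difference (square-nonNeg (h (ω u) - μ))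
        (solve 2 (λ h μ → μ :* (con 1ℚ :* h) :+ μ :* (con 1ℚ :* h) :+ (h :- μ) :* (h :- μ)
          := con 1ℚ :* (h :* h) :+ μ :* μ :* con 1ℚ) refl (h (ω u)) μ)
      ... | no _ = ℚ.≤-reflexive
        (solve 2 (λ h μ → μ :* (con 0ℚ :* h) :+ μ :* (con 0ℚ :* h)
          := con 0ℚ :* (h :* h) :+ μ :* μ :* con 0ℚ) refl (h (ω u)) μ)

      -- Each conditional probability in `𝔼-first` is bounded separately: it is 1 when the pivot
      -- settles the event, and for a pivot adjacent to both vertices it is at least the probability
      -- on `L′ x`.
      firstStep : ∀ {u} → u ∈ K L → ∑ L (Y u) ≤ ι (length L) * E L u
      firstStep {u} u∈ = ℚ.≤-trans (ℚ.≤-reflexive (sym (∑-select L (Y u))))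
        (ℚ.≤-trans (∑-mono (select L) (λ {(x , R)} → bound x R))
          (ℚ.≤-reflexive (sym (𝔼-first L (𝟙 ∘ wins? u)))))
        where
        bound : ∀ x R → (x , R) ∈ select L → Y u x ≤ 𝔼 R (𝟙 ∘ wins? u ∘ (x ∷_))
        bound x R xR∈ = go (near? x)
          where
          mem : ∀ {z σ} → z ∈ L → σ ∈ permutations R → z ∈ x ∷ σ
          mem z∈ σ∈ = ∈-resp-↭ (↭-trans (select-↭ xR∈) (prep x (↭-sym (∈-permutations⁻ R σ∈)))) z∈

          certain : (∀ {σ} → u ∈ x ∷ σ → v ∈ x ∷ σ → Wins u (x ∷ σ)) →
                    1ℚ ≤ 𝔼 R (𝟙 ∘ wins? u ∘ (x ∷_))
          certain wins = ℚ.≤-trans (ℚ.≤-reflexive (sym (𝔼-const R 1ℚ)))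
            (𝔼-mono R (λ {σ} σ∈ → ℚ.≤-reflexive
              (sym (pick-yes (wins? u (x ∷ σ)) (wins (mem (K⇒L u∈) σ∈) (mem v∈L σ∈))))))

          recursive : E (L′ x) u ≤ 𝔼 R (𝟙 ∘ wins? u ∘ (x ∷_))
          -- `R` is `L` without `x`, so both have the same neighbours of `x`, and `𝔼-filter` passes
          -- to a uniform ordering of these.
          recursive = ℚ.≤-trans
            (ℚ.≤-reflexive (trans (cong (λ M → E M u) (sym (filter-select (adj? G x) xR∈ (adj-irrefl G refl))))
              (sym (𝔼-filter (adj? G x) R (𝟙 ∘ wins? u)))))
            (𝔼-mono R (λ {σ} _ → 𝟙-mono (wins? u (filter (adj? G x) σ)) (wins? u (x ∷ σ)) (wins-∷ x σ)))

          go : Dec (Near x) → Y u x ≤ 𝔼 R (𝟙 ∘ wins? u ∘ (x ∷_))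
          go (yes nx) = ℚ.≤-trans (ℚ.≤-reflexive (pick-yes (near? x) nx)) (inside nx (cases x u))
            where
            inside : Near x → Cases x u → y x u ≤ 𝔼 R (𝟙 ∘ wins? u ∘ (x ∷_))
            inside _ (common _ _ eq) = ℚ.≤-trans (ℚ.≤-reflexive (eq _)) recursive
            inside (inj₁ refl) (separate _ eq) = ℚ.≤-trans (ℚ.≤-reflexive (eq _))
              (certain (λ {σ} u∈σ _ → wins-v σ (K⇒near u∈) u∈σ))
            inside (inj₂ vx) (separate ¬both eq) = ℚ.≤-trans (ℚ.≤-reflexive (eq _))
              (certain (λ {σ} u∈σ v∈σ → wins-v-only x σ u∈σ v∈σ (adj-sym G vx) (λ xu → ¬both (adj-sym G vx , xu))))
          go (no ¬nx) = ℚ.≤-trans (ℚ.≤-reflexive (pick-no (near? x) ¬nx)) (outside (adj? G u x))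
            where
            outside : (d : Dec (Adj G u x)) → 𝟙 d ≤ 𝔼 R (𝟙 ∘ wins? u ∘ (x ∷_))
            outside (yes ux) = certain (λ {σ} u∈σ v∈σ →
              wins-u-only x σ u∈σ v∈σ (¬nx ∘ inj₂ ∘ adj-sym G) (adj-sym G ux))
            outside (no _)   = ℚ.≤-trans (ℚ.≤-reflexive (sym (𝔼-const R 0ℚ)))
              (𝔼-mono R (λ {σ} _ → 𝟙-nonNeg (wins? u (x ∷ σ))))

      ss-pos : 0ℚ < s * s
      ss-pos = *-pos s-pos s-pos

      i : ℚ
      i = proj₁ (reciprocal ss-pos)

      0≤i : 0ℚ ≤ i
      0≤i = ℚ.<⇒≤ (proj₁ (proj₂ (reciprocal ss-pos)))

      iss≡1 : i * (s * s) ≡ 1ℚ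
      iss≡1 = proj₂ (proj₂ (reciprocal ss-pos))

      ℓ : ℚ
      ℓ = ι (length L)

      -- Cauchy-Schwarz gives s² ≤ (∑ T)(∑ Y) and `firstStep` gives ∑ Y ≤ ℓ E. Solving for 1/E
      -- yields this bound, with `i` = 1/s².
      A : Fin n → ℚ
      A u = i * ℓ * ∑ L (T u)

      ∑T-nonNeg : ∀ {u} → u ∈ K L → 0ℚ ≤ ∑ L (T u)
      ∑T-nonNeg {u} u∈ = subst (0ℚ ≤_) (sym (∑T u)) (+-nonNeg
        (∑-nonNeg (K L) (λ {x} x∈ → *-nonNeg (square-nonNeg (m x u)) (ℚ.≤-trans 0≤1 (1≤B x∈ u∈))))
        (*-nonNeg (ι-nonNeg (ω u)) (square-nonNeg (h (ω u)))))

      A-nonNeg : ∀ {u} → u ∈ K L → 0ℚ ≤ A u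
      A-nonNeg u∈ = *-nonNeg (*-nonNeg 0≤i (ι-nonNeg (length L))) (∑T-nonNeg u∈)

      1≤A*E : ∀ {u} → u ∈ K L → 1ℚ ≤ A u * E L u
      1≤A*E {u} u∈ = begin
        1ℚ                                  ≡⟨ iss≡1 ⟨
        i * (s * s)                         ≡⟨ cong (λ t → i * (t * t)) (∑W u) ⟨
        i * (∑ L (W u) * ∑ L (W u))         ≤⟨ *-mono-≤ 0≤i (cauchy L (W u) (T u) (Y u) (tangents u∈) (∑Y-pos u)) ⟩
        i * (∑ L (T u) * ∑ L (Y u))         ≤⟨ *-mono-≤ 0≤i (*-mono-≤ (∑T-nonNeg u∈) (firstStep u∈)) ⟩
        i * (∑ L (T u) * (ℓ * E L u))       ≡⟨ solve 4 (λ i t l e → i :* (t :* (l :* e)) := i :* l :* t :* e) refl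
                                                 i (∑ L (T u)) ℓ (E L u) ⟩
        A u * E L u                         ∎
        where open ℚ.≤-Reasoning

    bound : Bound L
    bound = record
      { A     = A
      -- A probability is at most 1, so `1≤A*E` forces this.
      ; 1≤A   = λ {u} u∈ → ℚ.≤-trans (1≤A*E u∈) (ℚ.≤-trans (*-mono-≤ (A-nonNeg u∈) (E≤1 L u))
                  (ℚ.≤-reflexive (ℚ.*-identityʳ (A u))))
      ; 1≤A*E = 1≤A*E
      ; total = begin
          ∑ (K L) A                          ≡⟨ ∑-*ˡ (K L) (i * ℓ) (λ u → ∑ L (T u)) ⟩
          i * ℓ * ∑ (K L) (λ u → ∑ L (T u))  ≡⟨ cong (i * ℓ *_) (∑-cong (K L) (λ {u} _ → ∑T u)) ⟩
          i * ℓ * _                          ≤⟨ *-mono-≤ (*-nonNeg 0≤i (ι-nonNeg (length L))) (energy B 1≤B rows) ⟩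
          i * ℓ * (s * s)                    ≡⟨ solve 3 (λ i l s → i :* l :* s := l :* (i :* s)) refl i ℓ (s * s) ⟩
          ℓ * (i * (s * s))                  ≡⟨ cong (ℓ *_) iss≡1 ⟩
          ℓ * 1ℚ                             ≡⟨ ℚ.*-identityʳ ℓ ⟩
          ℓ                                  ∎
      }
      where open ℚ.≤-Reasoning

  -- The recursion goes to L ∩ N(x), which is shorter because `x` is in `L` but not its own
  -- neighbour, and which contains `v` because `x` is adjacent to `v`.
  boundAll : ∀ L → v ∈ L → Bound L
  boundAll L = go (length L) L ℕ.≤-refl
    where
    go : ∀ k L → length L ℕ.≤ k → v ∈ L → Bound L
    go zero    []       _   ()
    go (suc k) L        len v∈ = Step.bound L v∈ λ x x∈ xv →
      go k (filter (adj? G x) L)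
        (ℕ.≤-pred (ℕ.≤-trans (filter-notAll (adj? G x) L (lose x∈ (adj-irrefl G refl))) len))
        (∈-filter⁺ (adj? G x) v∈ xv)

-- From the bounds to the reciprocals of p and q.

sum≤∑-tabulate : ∀ {n} {A : Set} (g : Fin n → A) {t : Fin n → ℚ} {f : A → ℚ} →
  (∀ i → t i ≤ f (g i)) → sum ℚ.+-0-rawMonoid t ≤ ∑ (tabulate g) f
sum≤∑-tabulate {zero}  g le = ℚ.≤-refl
sum≤∑-tabulate {suc n} g le = ℚ.+-mono-≤ (le zero) (sum≤∑-tabulate (g ∘ suc) (le ∘ suc))

∑N≤∑ : ∀ {n} (G : Graph n) v (f : ∀ u → Adj G v u → ℚ) (A : Fin n → ℚ) → (∀ u vu → f u vu ≤ A u) →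
  ∑N G v f ≤ ∑ (allFin n) (λ u → pick (adj? G v u) (A u) 0ℚ)
∑N≤∑ {n} G v f A le = sum≤∑-tabulate (λ i → i) summand≤
  where
  -- The summand of ∑N is local to its definition; unification recovers it.
  summands : ∃ λ t → ∑N G v f ≡ sum ℚ.+-0-rawMonoid {n} t
  summands = _ , refl

  summand≤ : ∀ u → proj₁ summands u ≤ pick (adj? G v u) (A u) 0ℚ
  summand≤ u with adj? G v u
  ... | yes vu = le u vu
  ... | no  _  = ℚ.≤-refl

Pr≡𝔼 : ∀ {n} {P : U.Pred (List (Fin n)) 0ℓ} (P? : U.Decidable P) → Pr P? ≡ 𝔼 (allFin n) (𝟙 ∘ P?)
Pr≡𝔼 {n} P? = *-cancelˡ (ι-pos (n !) {{n ℕ.!≢0}}) (begin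
  ι (n !) * Pr P?
    ≡⟨ ℚ.*-comm (ι (n !)) (Pr P?) ⟩
  Pr P? * ι (n !)
    ≡⟨ /-* (length (filter P? (orderings n))) (n !) {{n ℕ.!≢0}} ⟩
  ι (length (filter P? (orderings n)))
    ≡⟨ ℚ.*-identityʳ _ ⟨
  ι (length (filter P? (orderings n))) * 1ℚ
    ≡⟨ ∑-𝟙 P? (orderings n) 1ℚ ⟨
  ∑ (orderings n) (λ σ → 𝟙 (P? σ) * 1ℚ)
    ≡⟨ ∑-cong (orderings n) (λ {σ} _ → ℚ.*-identityʳ (𝟙 (P? σ))) ⟩
  ∑ (orderings n) (𝟙 ∘ P?)
    ≡⟨ !-𝔼 (allFin n) (𝟙 ∘ P?) ⟨
  ι (length (allFin n) !) * 𝔼 (allFin n) (𝟙 ∘ P?)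
    ≡⟨ cong (λ k → ι (k !) * 𝔼 (allFin n) (𝟙 ∘ P?)) (length-tabulate {n = n} (λ i → i)) ⟩
  ι (n !) * 𝔼 (allFin n) (𝟙 ∘ P?) ∎)
  where open ≡-Reasoning

lemma1p6 : (n : ℕ) → n ≥ 1 → (G : Graph n) (v : Fin n) → 1/p G v + ∑N G v (λ u vu → 1/q G v u vu) ≤ + n / 1
lemma1p6 n _ G v = begin
  1/p G v + ∑N G v (λ u vu → 1/q G v u vu)
    ≤⟨ ℚ.+-mono-≤ 1/p≤ (∑N≤∑ G v (λ u vu → 1/q G v u vu) A 1/q≤) ⟩
  A v + ∑ V (λ u → pick (adj? G v u) (A u) 0ℚ)
    -- `A v` is bounded by a sum over `V` supported at `v`, which merges with the sum over the
    -- neighbours into one over `K V`.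
    ≤⟨ ℚ.+-monoˡ-≤ (∑ V (λ u → pick (adj? G v u) (A u) 0ℚ)) A≤ ⟩
  ∑ V (λ u → pick (u Fin.≟ v) (A u) 0ℚ) + ∑ V (λ u → pick (adj? G v u) (A u) 0ℚ)
    ≡⟨ ∑-+ V (λ u → pick (u Fin.≟ v) (A u) 0ℚ) (λ u → pick (adj? G v u) (A u) 0ℚ) ⟨
  ∑ V (λ u → pick (u Fin.≟ v) (A u) 0ℚ + pick (adj? G v u) (A u) 0ℚ)
    ≡⟨ ∑-cong V (λ {u} _ → merge u) ⟩
  ∑ V (λ u → pick (near? u) (A u) 0ℚ)
    ≡⟨ ∑-filter near? V A ⟨
  ∑ (K V) A
    ≤⟨ total ⟩
  ι (length V)
    ≡⟨ cong ι (length-tabulate {n = n} (λ i → i)) ⟩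
  + n / 1 ∎
  where
  open ℚ.≤-Reasoning
  open At G v
  V : List (Fin n)
  V = allFin n
  open Bound (boundAll V (∈-allFin v))

  ∈K : ∀ {u} → Near u → u ∈ K V
  ∈K {u} = ∈-filter⁺ near? (∈-allFin u)

  0≤A : ∀ {u} → Near u → 0ℚ ≤ A u
  0≤A nu = ℚ.≤-trans 0≤1 (1≤A (∈K nu))

  -- An event implied by `Wins u` has probability at least `E V u`, so `A u` bounds its reciprocal
  -- too.
  1≤A*Pr : ∀ {u} {P : U.Pred (List (Fin n)) 0ℓ} (P? : U.Decidable P) → Near u →
           (∀ σ → Wins u σ → P σ) → 1ℚ ≤ A u * Pr P?
  1≤A*Pr {u} P? nu wins⇒ = ℚ.≤-trans (1≤A*E (∈K nu)) (*-mono-≤ (0≤A nu)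
    (ℚ.≤-trans (𝔼-mono V (λ {σ} _ → 𝟙-mono (wins? u σ) (P? σ) (wins⇒ σ)))
      (ℚ.≤-reflexive (sym (Pr≡𝔼 P?)))))

  0≤Pr : ∀ {P : U.Pred (List (Fin n)) 0ℓ} (P? : U.Decidable P) → 0ℚ ≤ Pr P?
  0≤Pr P? = ℚ.nonNegative⁻¹ (Pr P?)
    {{ℚ.normalize-nonNeg (length (filter P? (orderings n))) (n !) {{n ℕ.!≢0}}}}

  1/p≤ : 1/p G v ≤ A v
  1/p≤ = 1/-≤ {{p-nonZero G v}} (0≤Pr (IsPivot? G v)) (1≤A*Pr (IsPivot? G v) (inj₁ refl)
    λ { σ (inj₁ (_ , piv)) → piv ; σ (inj₂ (v≢v , _)) → ⊥-elim (v≢v refl) })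

  1/q≤ : ∀ u vu → 1/q G v u vu ≤ A u
  1/q≤ u vu = 1/-≤ {{q-nonZero G v u vu}} (0≤Pr (DifferentBlocks? G v u))
    (1≤A*Pr (DifferentBlocks? G v u) (inj₂ vu)
    λ { σ (inj₁ (u≡v , _)) → ⊥-elim (adj-irrefl G (sym u≡v) vu) ; σ (inj₂ (_ , diff)) → diff })

  A≤ : A v ≤ ∑ V (λ u → pick (u Fin.≟ v) (A u) 0ℚ)
  A≤ = ℚ.≤-trans (ℚ.≤-reflexive (sym (pick-yes (v Fin.≟ v) refl)))
    (≤∑ (∈-allFin v) (λ {u} _ → nonNeg u))
    where
    nonNeg : ∀ u → 0ℚ ≤ pick (u Fin.≟ v) (A u) 0ℚ
    nonNeg u with u Fin.≟ v
    ... | yes u≡v = 0≤A (inj₁ u≡v)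
    ... | no  _   = ℚ.≤-refl

  merge : ∀ u → pick (u Fin.≟ v) (A u) 0ℚ + pick (adj? G v u) (A u) 0ℚ ≡ pick (near? u) (A u) 0ℚ
  merge u with u Fin.≟ v | adj? G v u
  ... | yes u≡v | yes vu = ⊥-elim (adj-irrefl G (sym u≡v) vu)
  ... | yes _   | no  _  = ℚ.+-identityʳ (A u)
  ... | no  _   | yes _  = ℚ.+-identityˡ (A u)
  ... | no  _   | no  _  = refl
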